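{- Let $\lambda$ be a nonzero real number and $n$ a positive integer. Then $$\beta_{n-1,-\lambda}(2\lambda+1)=\sum_{k=1}^{n}(k-1)!\,(-1)^{n-k}H_{k,-\lambda}\,S_{2,\lambda}(n,k).$$
   Context: For a nonzero real parameter $\mu$ (used here with $\mu=\lambda$ and $\mu=-\lambda$), real $y$ and integer $k\ge0$: $(y)_{0,\mu}=1$, $(y)_{k,\mu}=y(y-\mu)\cdots(y-(k-1)\mu)$; $(y)_0=1$, $(y)_k=y(y-1)\cdots(y-k+1)$. The degenerate exponential is $e_\mu^x(t)=\sum_{k\ge0}(x)_{k,\mu}t^k/k!=(1+\mu t)^{x/\mu}$, $e_\mu(t)=e^1_\mu(t)$. The degenerate Bernoulli polynomials are defined by $\frac{t}{e_\mu(t)-1}e_\mu^x(t)=\sum_{n\ge0}\beta_{n,\mu}(x)\frac{t^n}{n!}$. The degenerate Stirling numbers of the second kind $S_{2,\mu}(n,k)$ are defined by $(x)_{n,\mu}=\sum_{k=0}^{n}S_{2,\mu}(n,k)(x)_{k}$ ($n\ge0$). The degenerate harmonic numbers are $H_{0,\mu}=0$ and $H_{n,\mu}=\sum_{k=1}^{n}\frac{1}{\mu}\binom{\mu}{k}(-1)^{k-1}$ for $n\ge1$. -}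

module Defs where

open import Algebra.Bundles using (CommutativeRing)
open import Data.Fin.Base using (Fin; zero; suc; toℕ; fromℕ; inject₁)
import Data.Fin.Properties as Fin
open import Data.Integer.Base using (+_)
open import Data.Nat.Base as ℕ using (ℕ; zero; suc; _∸_; _!)
import Data.Nat.Properties as ℕ
open import Data.Product.Base using (∃; _×_; _,_; proj₁; proj₂)
open import Data.Rational.Base as ℚ using (ℚ; 0ℚ; 1ℚ; ½)
import Data.Rational.Properties as ℚ
import Data.Rational.Solver as ℚ-Solver
open import Data.Vec.Functional using (Vector; _∷_)
open import Level using (0ℓ)
open import Relation.Binary.PropositionalEquality as ≡ using (_≡_; _≢_)
open import Relation.Nullary using (yes; no; contradiction)

IsCauchy : (ℕ → ℚ) → Set
IsCauchy s = ∀ ε → 0ℚ ℚ.< ε →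
  ∃ λ N → ∀ m n → N ℕ.≤ m → N ℕ.≤ n → ℚ.∣ s m ℚ.- s n ∣ ℚ.< ε

-- Cauchy reals. Eta is off so that the conversion checker does not compare
-- the Cauchy proofs of two reals.
record ℝ : Set where
  no-eta-equality
  constructor mkℝ
  field
    seq    : ℕ → ℚ
    cauchy : IsCauchy seq

open ℝ public

infix 4 _≈_ _#_

record _≈_ (x y : ℝ) : Set where
  no-eta-equality; pattern
  constructor mk≈
  field
    close : ∀ ε → 0ℚ ℚ.< ε →
      ∃ λ N → ∀ n → N ℕ.≤ n → ℚ.∣ seq x n ℚ.- seq y n ∣ ℚ.< ε

-- The constructive form of x ≠ y: only apartness from 0 makes x invertible.
record _#_ (x y : ℝ) : Set where
  constructor mk#
  field
    gap   : ℚ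
    0<gap : 0ℚ ℚ.< gap
    from  : ℕ
    apart : ∀ n → from ℕ.≤ n → gap ℚ.≤ ℚ.∣ seq x n ℚ.- seq y n ∣

private
  open ℚ-Solver.+-*-Solver using (solve; con; _:+_; _:*_; _:-_; :-_; _:=_)

  halves : ∀ ε → ½ ℚ.* ε ℚ.+ ½ ℚ.* ε ≡ ε
  halves = solve 1 (λ e → con ½ :* e :+ con ½ :* e := e) ≡.refl

  0<p*q : ∀ {p q} → 0ℚ ℚ.< p → 0ℚ ℚ.< q → 0ℚ ℚ.< p ℚ.* q
  0<p*q {p} {q} 0<p 0<q =
    ℚ.positive⁻¹ _ {{ℚ.pos*pos⇒pos p {{ℚ.positive 0<p}} q {{ℚ.positive 0<q}}}}

  0<½ε : ∀ {ε} → 0ℚ ℚ.< ε → 0ℚ ℚ.< ½ ℚ.* ε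
  0<½ε = 0<p*q (ℚ.positive⁻¹ ½)

  -- Used with single indices (for _≈_) and with pairs (for IsCauchy).
  module Tails {I : Set} (Tail : ℕ → I → Set)
               (weaken : ∀ {M N i} → M ℕ.≤ N → Tail N i → Tail M i) where

    Eventually : (I → Set) → Set
    Eventually P = ∃ λ N → ∀ i → Tail N i → P i

    Vanishes : (I → ℚ) → Set
    Vanishes f = ∀ ε → 0ℚ ℚ.< ε → Eventually λ i → ℚ.∣ f i ∣ ℚ.< ε

    Bounded : (I → ℚ) → Set
    Bounded f = ∃ λ B → 0ℚ ℚ.< B × Eventually λ i → ℚ.∣ f i ∣ ℚ.≤ B

    both : ∀ {P Q R : I → Set} → (∀ i → P i → Q i → R i) →
           Eventually P → Eventually Q → Eventually R
    both h (M , p) (N , q) = M ℕ.⊔ N , λ i t →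
      h i (p i (weaken (ℕ.m≤m⊔n M N) t)) (q i (weaken (ℕ.m≤n⊔m M N) t))

    always : ∀ {P : I → Set} → (∀ i → P i) → Eventually P
    always p = 0 , λ i _ → p i

    vanishes-resp : ∀ {f g} → Eventually (λ i → f i ≡ g i) → Vanishes f → Vanishes g
    vanishes-resp f≡g v ε 0<ε =
      both (λ _ eq → ≡.subst (λ q → ℚ.∣ q ∣ ℚ.< ε) eq) f≡g (v ε 0<ε)

    vanishes-0 : ∀ {f} → (∀ i → f i ≡ 0ℚ) → Vanishes f
    vanishes-0 f≡0 ε 0<ε = always λ i →
      ≡.subst (λ q → ℚ.∣ q ∣ ℚ.< ε) (≡.sym (f≡0 i)) 0<ε

    vanishes-+ : ∀ {f g} → Vanishes f → Vanishes g → Vanishes (λ i → f i ℚ.+ g i)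
    vanishes-+ {f} {g} v w ε 0<ε =
      both (λ i p q → ℚ.≤-<-trans (ℚ.∣p+q∣≤∣p∣+∣q∣ (f i) (g i))
                        (≡.subst (_ ℚ.<_) (halves ε) (ℚ.+-mono-< p q)))
        (v (½ ℚ.* ε) (0<½ε 0<ε)) (w (½ ℚ.* ε) (0<½ε 0<ε))

    vanishes-neg : ∀ {f} → Vanishes f → Vanishes (λ i → ℚ.- f i)
    vanishes-neg {f} v ε 0<ε with v ε 0<ε
    ... | N , p = N , λ i t → ≡.subst (ℚ._< ε) (≡.sym (ℚ.∣-p∣≡∣p∣ (f i))) (p i t)

    vanishes-* : ∀ {b f} → Bounded b → Vanishes f → Vanishes (λ i → b i ℚ.* f i)
    vanishes-* {b} {f} (B , 0<B , bd) v ε 0<ε =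
      both (λ i p q → begin-strict
              ℚ.∣ b i ℚ.* f i ∣          ≡⟨ ℚ.∣p*q∣≡∣p∣*∣q∣ (b i) (f i) ⟩
              ℚ.∣ b i ∣ ℚ.* ℚ.∣ f i ∣    ≤⟨ ℚ.*-monoʳ-≤-nonNeg ℚ.∣ f i ∣ {{ℚ.∣-∣-nonNeg (f i)}} p ⟩
              B ℚ.* ℚ.∣ f i ∣            <⟨ ℚ.*-monoʳ-<-pos B q ⟩
              B ℚ.* ((ℚ.1/ B) ℚ.* ε)     ≡⟨ ℚ.*-assoc B (ℚ.1/ B) ε ⟨
              B ℚ.* (ℚ.1/ B) ℚ.* ε       ≡⟨ ≡.cong (ℚ._* ε) (ℚ.*-inverseʳ B) ⟩
              1ℚ ℚ.* ε                   ≡⟨ ℚ.*-identityˡ ε ⟩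
              ε                          ∎)
        bd (v ((ℚ.1/ B) ℚ.* ε) (0<p*q (ℚ.positive⁻¹ (ℚ.1/ B) {{ℚ.1/pos⇒pos B}}) 0<ε))
      where
      open ℚ.≤-Reasoning
      instance
        B-pos : ℚ.Positive B
        B-pos = ℚ.positive 0<B
        B≢0 : ℚ.NonZero B
        B≢0 = ℚ.pos⇒nonZero B

    bounded-* : ∀ {b c} → Bounded b → Bounded c → Bounded (λ i → b i ℚ.* c i)
    bounded-* {b} {c} (B , 0<B , p) (C , 0<C , q) = B ℚ.* C , 0<p*q 0<B 0<C ,
      both (λ i ∣b∣≤B ∣c∣≤C → begin
              ℚ.∣ b i ℚ.* c i ∣          ≡⟨ ℚ.∣p*q∣≡∣p∣*∣q∣ (b i) (c i) ⟩
              ℚ.∣ b i ∣ ℚ.* ℚ.∣ c i ∣    ≤⟨ ℚ.*-monoʳ-≤-nonNeg ℚ.∣ c i ∣ {{ℚ.∣-∣-nonNeg (c i)}} ∣b∣≤B ⟩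
              B ℚ.* ℚ.∣ c i ∣            ≤⟨ ℚ.*-monoˡ-≤-nonNeg B {{ℚ.pos⇒nonNeg B {{ℚ.positive 0<B}}}} ∣c∣≤C ⟩
              B ℚ.* C                    ∎) p q
      where open ℚ.≤-Reasoning

  module T₁ = Tails {ℕ} ℕ._≤_ ℕ.≤-trans

  Tail₂ : ℕ → ℕ × ℕ → Set
  Tail₂ N (m , n) = N ℕ.≤ m × N ℕ.≤ n

  module T₂ = Tails Tail₂ (λ M≤N (p , q) → ℕ.≤-trans M≤N p , ℕ.≤-trans M≤N q)

  Diff : (ℕ → ℚ) → ℕ × ℕ → ℚ
  Diff s (m , n) = s m ℚ.- s n

  toPairs : (x : ℝ) → T₂.Vanishes (Diff (seq x))
  toPairs x ε 0<ε with cauchy x ε 0<ε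
  ... | N , p = N , λ (m , n) (t , u) → p m n t u

  fromPairs : ∀ s → T₂.Vanishes (Diff s) → IsCauchy s
  fromPairs s v ε 0<ε with v ε 0<ε
  ... | N , p = N , λ m n t u → p (m , n) (t , u)

  atFst : ∀ {f} → T₁.Bounded f → T₂.Bounded (λ p → f (proj₁ p))
  atFst (B , 0<B , N , p) = B , 0<B , N , λ (m , _) (t , _) → p m t

  atSnd : ∀ {f} → T₁.Bounded f → T₂.Bounded (λ p → f (proj₂ p))
  atSnd (B , 0<B , N , p) = B , 0<B , N , λ (_ , n) (_ , t) → p n t

  bounded : (x : ℝ) → T₁.Bounded (seq x)
  bounded x with cauchy x 1ℚ (ℚ.positive⁻¹ 1ℚ)
  ... | N , p = 1ℚ ℚ.+ ℚ.∣ seq x N ∣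
              , ℚ.+-mono-<-≤ (ℚ.positive⁻¹ 1ℚ) (ℚ.0≤∣p∣ (seq x N))
              , N , λ n N≤n → begin
      ℚ.∣ seq x n ∣                                 ≡⟨ ≡.cong ℚ.∣_∣ (split (seq x n) (seq x N)) ⟩
      ℚ.∣ (seq x n ℚ.- seq x N) ℚ.+ seq x N ∣       ≤⟨ ℚ.∣p+q∣≤∣p∣+∣q∣ (seq x n ℚ.- seq x N) (seq x N) ⟩
      ℚ.∣ seq x n ℚ.- seq x N ∣ ℚ.+ ℚ.∣ seq x N ∣   ≤⟨ ℚ.+-monoˡ-≤ ℚ.∣ seq x N ∣ (ℚ.<⇒≤ (p n N N≤n ℕ.≤-refl)) ⟩
      1ℚ ℚ.+ ℚ.∣ seq x N ∣                          ∎
    where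
    open ℚ.≤-Reasoning
    split : ∀ a b → a ≡ (a ℚ.- b) ℚ.+ b
    split = solve 2 (λ a b → a := (a :- b) :+ b) ≡.refl

fromℚ : ℚ → ℝ
seq    (fromℚ q) _ = q
cauchy (fromℚ q)   = fromPairs (λ _ → q) (T₂.vanishes-0 λ _ → ℚ.+-inverseʳ q)

fromNat : ℕ → ℝ
fromNat n = fromℚ (+ n ℚ./ 1)

0ℝ 1ℝ : ℝ
0ℝ = fromℚ 0ℚ
1ℝ = fromℚ 1ℚ

infix  8 -_
infixl 7 _*_
infixl 6 _+_ _-_

_+_ : ℝ → ℝ → ℝ
seq    (x + y) n = seq x n ℚ.+ seq y n
cauchy (x + y)   = fromPairs (λ n → seq x n ℚ.+ seq y n) (T₂.vanishes-resp
  (T₂.always λ (m , n) → regroup (seq x m) (seq x n) (seq y m) (seq y n))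
  (T₂.vanishes-+ (toPairs x) (toPairs y)))
  where
  regroup : ∀ a b c d → (a ℚ.- b) ℚ.+ (c ℚ.- d) ≡ (a ℚ.+ c) ℚ.- (b ℚ.+ d)
  regroup = solve 4 (λ a b c d → (a :- b) :+ (c :- d) := (a :+ c) :- (b :+ d)) ≡.refl

-_ : ℝ → ℝ
seq    (- x) n = ℚ.- seq x n
cauchy (- x)   = fromPairs (λ n → ℚ.- seq x n) (T₂.vanishes-resp
  (T₂.always λ (m , n) → regroup (seq x m) (seq x n))
  (T₂.vanishes-neg (toPairs x)))
  where
  regroup : ∀ a b → ℚ.- (a ℚ.- b) ≡ (ℚ.- a) ℚ.- (ℚ.- b)
  regroup = solve 2 (λ a b → :- (a :- b) := (:- a) :- (:- b)) ≡.refl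

_*_ : ℝ → ℝ → ℝ
seq    (x * y) n = seq x n ℚ.* seq y n
cauchy (x * y)   = fromPairs (λ n → seq x n ℚ.* seq y n) (T₂.vanishes-resp
  (T₂.always λ (m , n) → regroup (seq x m) (seq x n) (seq y m) (seq y n))
  (T₂.vanishes-+ (T₂.vanishes-* (atFst (bounded x)) (toPairs y))
                 (T₂.vanishes-* (atSnd (bounded y)) (toPairs x))))
  where
  regroup : ∀ a b c d → a ℚ.* (c ℚ.- d) ℚ.+ d ℚ.* (a ℚ.- b) ≡ a ℚ.* c ℚ.- b ℚ.* d
  regroup = solve 4 (λ a b c d → a :* (c :- d) :+ d :* (a :- b) := a :* c :- b :* d) ≡.refl

_-_ : ℝ → ℝ → ℝ
x - y = x + (- y)

pointwise : ∀ {x y} → (∀ n → seq x n ≡ seq y n) → x ≈ y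
pointwise {x} {y} eq = mk≈ (T₁.vanishes-0 λ n →
  ≡.trans (≡.cong (ℚ._- seq y n) (eq n)) (ℚ.+-inverseʳ (seq y n)))

private
  ≈-refl : ∀ {x} → x ≈ x
  ≈-refl = pointwise λ _ → ≡.refl

  ≈-sym : ∀ {x y} → x ≈ y → y ≈ x
  ≈-sym {x} {y} (mk≈ p) = mk≈ (T₁.vanishes-resp
    (T₁.always λ n → flip (seq x n) (seq y n)) (T₁.vanishes-neg p))
    where
    flip : ∀ a b → ℚ.- (a ℚ.- b) ≡ b ℚ.- a
    flip = solve 2 (λ a b → :- (a :- b) := b :- a) ≡.refl

  ≈-trans : ∀ {x y z} → x ≈ y → y ≈ z → x ≈ z
  ≈-trans {x} {y} {z} (mk≈ p) (mk≈ q) = mk≈ (T₁.vanishes-resp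
    (T₁.always λ n → chain (seq x n) (seq y n) (seq z n)) (T₁.vanishes-+ p q))
    where
    chain : ∀ a b c → (a ℚ.- b) ℚ.+ (b ℚ.- c) ≡ a ℚ.- c
    chain = solve 3 (λ a b c → (a :- b) :+ (b :- c) := a :- c) ≡.refl

  +-cong : ∀ {x y u v} → x ≈ y → u ≈ v → x + u ≈ y + v
  +-cong {x} {y} {u} {v} (mk≈ p) (mk≈ q) = mk≈ (T₁.vanishes-resp
    (T₁.always λ n → regroup (seq x n) (seq y n) (seq u n) (seq v n)) (T₁.vanishes-+ p q))
    where
    regroup : ∀ a b c d → (a ℚ.- b) ℚ.+ (c ℚ.- d) ≡ (a ℚ.+ c) ℚ.- (b ℚ.+ d)
    regroup = solve 4 (λ a b c d → (a :- b) :+ (c :- d) := (a :+ c) :- (b :+ d)) ≡.refl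

  -‿cong : ∀ {x y} → x ≈ y → - x ≈ - y
  -‿cong {x} {y} (mk≈ p) = mk≈ (T₁.vanishes-resp
    (T₁.always λ n → regroup (seq x n) (seq y n)) (T₁.vanishes-neg p))
    where
    regroup : ∀ a b → ℚ.- (a ℚ.- b) ≡ (ℚ.- a) ℚ.- (ℚ.- b)
    regroup = solve 2 (λ a b → :- (a :- b) := (:- a) :- (:- b)) ≡.refl

  *-cong : ∀ {x y u v} → x ≈ y → u ≈ v → x * u ≈ y * v
  *-cong {x} {y} {u} {v} (mk≈ p) (mk≈ q) = mk≈ (T₁.vanishes-resp
    (T₁.always λ n → regroup (seq x n) (seq y n) (seq u n) (seq v n))
    (T₁.vanishes-+ (T₁.vanishes-* (bounded x) q) (T₁.vanishes-* (bounded v) p)))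
    where
    regroup : ∀ a b c d → a ℚ.* (c ℚ.- d) ℚ.+ d ℚ.* (a ℚ.- b) ≡ a ℚ.* c ℚ.- b ℚ.* d
    regroup = solve 4 (λ a b c d → a :* (c :- d) :+ d :* (a :- b) := a :* c :- b :* d) ≡.refl

  +-assoc : ∀ x y z → (x + y) + z ≈ x + (y + z)
  +-assoc x y z = pointwise λ n → ℚ.+-assoc (seq x n) (seq y n) (seq z n)

  +-comm : ∀ x y → x + y ≈ y + x
  +-comm x y = pointwise λ n → ℚ.+-comm (seq x n) (seq y n)

  +-identityˡ : ∀ x → 0ℝ + x ≈ x
  +-identityˡ x = pointwise λ n → ℚ.+-identityˡ (seq x n)

  +-identityʳ : ∀ x → x + 0ℝ ≈ x
  +-identityʳ x = pointwise λ n → ℚ.+-identityʳ (seq x n)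

  +-inverseˡ : ∀ x → - x + x ≈ 0ℝ
  +-inverseˡ x = pointwise λ n → ℚ.+-inverseˡ (seq x n)

  +-inverseʳ : ∀ x → x + - x ≈ 0ℝ
  +-inverseʳ x = pointwise λ n → ℚ.+-inverseʳ (seq x n)

  *-assoc : ∀ x y z → (x * y) * z ≈ x * (y * z)
  *-assoc x y z = pointwise λ n → ℚ.*-assoc (seq x n) (seq y n) (seq z n)

  *-comm : ∀ x y → x * y ≈ y * x
  *-comm x y = pointwise λ n → ℚ.*-comm (seq x n) (seq y n)

  *-identityˡ : ∀ x → 1ℝ * x ≈ x
  *-identityˡ x = pointwise λ n → ℚ.*-identityˡ (seq x n)

  *-identityʳ : ∀ x → x * 1ℝ ≈ x
  *-identityʳ x = pointwise λ n → ℚ.*-identityʳ (seq x n)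

  *-distribˡ-+ : ∀ x y z → x * (y + z) ≈ x * y + x * z
  *-distribˡ-+ x y z = pointwise λ n → ℚ.*-distribˡ-+ (seq x n) (seq y n) (seq z n)

  *-distribʳ-+ : ∀ x y z → (y + z) * x ≈ y * x + z * x
  *-distribʳ-+ x y z = pointwise λ n → ℚ.*-distribʳ-+ (seq x n) (seq y n) (seq z n)

ℝ-commutativeRing : CommutativeRing 0ℓ 0ℓ
ℝ-commutativeRing = record
  { Carrier = ℝ
  ; _≈_ = _≈_
  ; _+_ = _+_
  ; _*_ = _*_
  ; -_ = -_
  ; 0# = 0ℝ
  ; 1# = 1ℝ
  ; isCommutativeRing = record
    { isRing = record
      { +-isAbelianGroup = record
        { isGroup = record
          { isMonoid = record
            { isSemigroup = record
              { isMagma = record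
                { isEquivalence = record { refl = ≈-refl ; sym = ≈-sym ; trans = ≈-trans }
                ; ∙-cong = +-cong
                }
              ; assoc = +-assoc
              }
            ; identity = +-identityˡ , +-identityʳ
            }
          ; inverse = +-inverseˡ , +-inverseʳ
          ; ⁻¹-cong = -‿cong
          }
        ; comm = +-comm
        }
      ; *-cong = *-cong
      ; *-assoc = *-assoc
      ; *-identity = *-identityˡ , *-identityʳ
      ; distrib = *-distribˡ-+ , *-distribʳ-+
      }
    ; *-comm = *-comm
    }
  }

private
  -- Finitely many terms of a real apart from 0 may vanish; they are sent to 0.
  inv : ℚ → ℚ
  inv q with q ℚ.≟ 0ℚ
  ... | yes _   = 0ℚ
  ... | no  q≢0 = (ℚ.1/ q) {{ℚ.≢-nonZero q≢0}}

  inv-inverse : ∀ {q} → q ≢ 0ℚ → q ℚ.* inv q ≡ 1ℚ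
  inv-inverse {q} q≢0 with q ℚ.≟ 0ℚ
  ... | yes q≡0 = contradiction q≡0 q≢0
  ... | no  q≢0 = ℚ.*-inverseʳ q {{ℚ.≢-nonZero q≢0}}

  gap⇒≢0 : ∀ {δ q} → 0ℚ ℚ.< δ → δ ℚ.≤ ℚ.∣ q ∣ → q ≢ 0ℚ
  gap⇒≢0 0<δ δ≤∣q∣ ≡.refl = ℚ.<-irrefl ≡.refl (ℚ.<-≤-trans 0<δ δ≤∣q∣)

  gap⇒inv-bound : ∀ {δ} (0<δ : 0ℚ ℚ.< δ) {q} → δ ℚ.≤ ℚ.∣ q ∣ →
                  ℚ.∣ inv q ∣ ℚ.≤ (ℚ.1/ δ) {{ℚ.pos⇒nonZero δ {{ℚ.positive 0<δ}}}}
  gap⇒inv-bound {δ} 0<δ {q} δ≤∣q∣ = ℚ.*-cancelˡ-≤-pos δ (begin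
    δ ℚ.* ℚ.∣ inv q ∣            ≤⟨ ℚ.*-monoʳ-≤-nonNeg ℚ.∣ inv q ∣ {{ℚ.∣-∣-nonNeg (inv q)}} δ≤∣q∣ ⟩
    ℚ.∣ q ∣ ℚ.* ℚ.∣ inv q ∣      ≡⟨ ℚ.∣p*q∣≡∣p∣*∣q∣ q (inv q) ⟨
    ℚ.∣ q ℚ.* inv q ∣            ≡⟨ ≡.cong ℚ.∣_∣ (inv-inverse (gap⇒≢0 0<δ δ≤∣q∣)) ⟩
    1ℚ                           ≡⟨ ℚ.*-inverseʳ δ ⟨
    δ ℚ.* (ℚ.1/ δ)               ∎)
    where
    open ℚ.≤-Reasoning
    instance
      δ-pos : ℚ.Positive δ
      δ-pos = ℚ.positive 0<δ
      δ≢0 : ℚ.NonZero δ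
      δ≢0 = ℚ.pos⇒nonZero δ

  minus0 : ∀ q → q ℚ.- 0ℚ ≡ q
  minus0 = solve 1 (λ q → q :- con 0ℚ := q) ≡.refl

  gap₀ : ∀ {x} (p : x # 0ℝ) n → _#_.from p ℕ.≤ n → _#_.gap p ℚ.≤ ℚ.∣ seq x n ∣
  gap₀ {x} p n t = ≡.subst (λ q → _#_.gap p ℚ.≤ ℚ.∣ q ∣) (minus0 (seq x n)) (_#_.apart p n t)

infix 9 _⁻¹⟨_⟩

_⁻¹⟨_⟩ : (x : ℝ) → x # 0ℝ → ℝ
seq    (x ⁻¹⟨ p ⟩) n = inv (seq x n)
cauchy (x ⁻¹⟨ p ⟩)   = fromPairs (λ n → inv (seq x n)) (T₂.vanishes-resp
  (N , λ (m , n) (t , u) → regroup (seq x m) (seq x n) (≢0 m t) (≢0 n u))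
  (T₂.vanishes-* (T₂.bounded-* (atFst inv-bounded) (atSnd inv-bounded))
    (T₂.vanishes-neg (toPairs x))))
  where
  open _#_ p renaming (from to N)
  ≢0 : ∀ n → N ℕ.≤ n → seq x n ≢ 0ℚ
  ≢0 n t = gap⇒≢0 0<gap (gap₀ p n t)

  inv-bounded : T₁.Bounded (λ n → inv (seq x n))
  inv-bounded = (ℚ.1/ gap) {{gap≢0}}
    , ℚ.positive⁻¹ _ {{ℚ.1/pos⇒pos gap {{ℚ.positive 0<gap}}}}
    , N , λ n t → gap⇒inv-bound 0<gap (gap₀ p n t)
    where
    gap≢0 : ℚ.NonZero gap
    gap≢0 = ℚ.pos⇒nonZero gap {{ℚ.positive 0<gap}}

  expand : ∀ a b c d → c ℚ.* d ℚ.* (ℚ.- (a ℚ.- b)) ≡ c ℚ.* (b ℚ.* d) ℚ.- d ℚ.* (a ℚ.* c)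
  expand = solve 4 (λ a b c d → c :* d :* (:- (a :- b)) := c :* (b :* d) :- d :* (a :* c)) ≡.refl

  regroup : ∀ a b → a ≢ 0ℚ → b ≢ 0ℚ →
            inv a ℚ.* inv b ℚ.* (ℚ.- (a ℚ.- b)) ≡ inv a ℚ.- inv b
  regroup a b a≢0 b≢0 = ≡.trans (expand a b (inv a) (inv b)) (≡.cong₂ ℚ._-_
    (≡.trans (≡.cong (inv a ℚ.*_) (inv-inverse b≢0)) (ℚ.*-identityʳ (inv a)))
    (≡.trans (≡.cong (inv b ℚ.*_) (inv-inverse a≢0)) (ℚ.*-identityʳ (inv b))))

⁻¹-inverseʳ : ∀ x (p : x # 0ℝ) → x * x ⁻¹⟨ p ⟩ ≈ 1ℝ
⁻¹-inverseʳ x p = mk≈ (T₁.vanishes-resp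
  (from , λ n t → ≡.sym (≡.trans (≡.cong (ℚ._- 1ℚ) (inv-inverse (gap⇒≢0 0<gap (gap₀ p n t))))
                                 (ℚ.+-inverseʳ 1ℚ)))
  (T₁.vanishes-0 {λ _ → 0ℚ} λ _ → ≡.refl))
  where open _#_ p

-‿#0 : ∀ {x} → x # 0ℝ → - x # 0ℝ
-‿#0 {x} p@(mk# δ 0<δ N _) = mk# δ 0<δ N λ n t →
  ≡.subst (δ ℚ.≤_)
    (≡.trans (≡.sym (ℚ.∣-p∣≡∣p∣ (seq x n))) (≡.cong ℚ.∣_∣ (≡.sym (minus0 (ℚ.- seq x n)))))
    (gap₀ p n t)

open CommutativeRing ℝ-commutativeRing using (semiring)
open import Algebra.Properties.Semiring.Exp semiring public using (_^_)
open import Algebra.Properties.Semiring.Sum semiring using (sum-syntax; sum⁺-syntax)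

fromℚ-+ : ∀ p q → fromℚ (p ℚ.+ q) ≈ fromℚ p + fromℚ q
fromℚ-+ p q = pointwise λ _ → ≡.refl

fromℚ-* : ∀ p q → fromℚ (p ℚ.* q) ≈ fromℚ p * fromℚ q
fromℚ-* p q = pointwise λ _ → ≡.refl

-- ∑₀ n f = ∑_{k=0}^n f(k) and ∑₁ n f = ∑_{k=1}^n f(k).
∑₀ ∑₁ : ℕ → (ℕ → ℝ) → ℝ
∑₀ n f = ∑[ i ≤ n ] f (toℕ i)
∑₁ n f = ∑[ i < n ] f (suc (toℕ i))

infix 10 1/_!

1/_! : ℕ → ℝ
1/ k ! = fromℚ ((+ 1 ℚ./ (k !)) {{k ℕ.!≢0}})

-- (y)_k
falling : ℝ → ℕ → ℝ
falling y zero    = 1ℝ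
falling y (suc k) = falling y k * (y - fromNat k)

-- (y)_{k,μ}
degFalling : ℝ → ℝ → ℕ → ℝ
degFalling μ y zero    = 1ℝ
degFalling μ y (suc k) = degFalling μ y k * (y - fromNat k * μ)

binomial : ℝ → ℕ → ℝ
binomial y k = falling y k * 1/ k !

-- Formal power series in t; f n is the coefficient of tⁿ (not of tⁿ/n!).
Series : Set
Series = ℕ → ℝ

infix  4 _≈ₛ_
infixl 7 _*ₛ_
infixl 6 _-ₛ_

_≈ₛ_ : Series → Series → Set
f ≈ₛ g = ∀ n → f n ≈ g n

1ₛ t : Series
1ₛ zero    = 1ℝ
1ₛ (suc _) = 0ℝ
t zero     = 0ℝ
t (suc n)  = 1ₛ n

_-ₛ_ _*ₛ_ : Series → Series → Series
(f -ₛ g) n = f n - g n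
(f *ₛ g) n = ∑₀ n λ k → f k * g (n ∸ k)

-- The coefficients n, n-1, …, 0 of 1/f, for f with constant term 1.
reciprocalUpTo : Series → ∀ n → Vector ℝ (suc n)
reciprocalUpTo f zero    = λ _ → 1ℝ
reciprocalUpTo f (suc n) = (- ∑[ i ≤ n ] (f (suc (toℕ i)) * g i)) ∷ g
  where g = reciprocalUpTo f n

reciprocal : Series → Series
reciprocal f n = reciprocalUpTo f n zero

private
  module R = CommutativeRing ℝ-commutativeRing
  open import Relation.Binary.Reasoning.Setoid R.setoid
  open import Algebra.Properties.Ring R.ring using (-0#≈0#)
  open import Algebra.Properties.Semiring.Sum semiring
    using (sum; sum-cong-≋; sum-cong-≗; sum-init-last; ∑-distrib-+; *-distribʳ-sum)

  reciprocalUpTo-lookup : ∀ f n i → reciprocalUpTo f n i ≡ reciprocal f (n ∸ toℕ i)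
  reciprocalUpTo-lookup f zero    zero    = ≡.refl
  reciprocalUpTo-lookup f (suc n) zero    = ≡.refl
  reciprocalUpTo-lookup f (suc n) (suc i) = reciprocalUpTo-lookup f n i

reciprocal-inverseʳ : ∀ f → f 0 ≈ 1ℝ → f *ₛ reciprocal f ≈ₛ 1ₛ
reciprocal-inverseʳ f f0≈1 zero    =
  R.trans (R.+-identityʳ _) (R.trans (R.*-identityʳ (f 0)) f0≈1)
reciprocal-inverseʳ f f0≈1 (suc n) = begin
  f 0 * (- S) + ∑[ i ≤ n ] (f (suc (toℕ i)) * reciprocal f (n ∸ toℕ i))
    ≈⟨ R.+-cong (R.trans (R.*-congʳ f0≈1) (R.*-identityˡ (- S)))
         (R.reflexive (sum-cong-≗ {suc n} λ i → ≡.cong (f (suc (toℕ i)) *_)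
           (≡.sym (reciprocalUpTo-lookup f n i)))) ⟩
  (- S) + S
    ≈⟨ R.-‿inverseˡ S ⟩
  0ℝ ∎
  where S = ∑[ i ≤ n ] (f (suc (toℕ i)) * reciprocalUpTo f n i)

-- e_μ^x(t)
degExp : ℝ → ℝ → Series
degExp μ x k = degFalling μ x k * 1/ k !

-- t / (e_μ(t) - 1) is the reciprocal of (e_μ(t) - 1) / t.
t/⟨degExp-1⟩ : ℝ → Series
t/⟨degExp-1⟩ μ = reciprocal λ n → degExp μ 1ℝ (suc n)

private
  e0-1*x≈0 : ∀ μ x → (degExp μ 1ℝ 0 - 1ℝ) * x ≈ 0ℝ
  e0-1*x≈0 μ x = R.trans
    (R.*-congʳ (R.trans (R.+-congʳ (R.*-identityˡ 1ℝ)) (R.-‿inverseʳ 1ℝ))) (R.zeroˡ x)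

  x-0≈x : ∀ x → x - 0ℝ ≈ x
  x-0≈x x = R.trans (R.+-congˡ -0#≈0#) (R.+-identityʳ x)

  e1≈1 : ∀ μ → degExp μ 1ℝ 1 ≈ 1ℝ
  e1≈1 μ = begin
    1ℝ * (1ℝ - 0ℝ * μ) * 1ℝ  ≈⟨ R.*-identityʳ _ ⟩
    1ℝ * (1ℝ - 0ℝ * μ)       ≈⟨ R.*-identityˡ _ ⟩
    1ℝ - 0ℝ * μ              ≈⟨ R.+-congˡ (R.trans (R.-‿cong (R.zeroˡ μ)) -0#≈0#) ⟩
    1ℝ + 0ℝ                  ≈⟨ R.+-identityʳ 1ℝ ⟩
    1ℝ                       ∎

t/⟨degExp-1⟩-correct : ∀ μ → (degExp μ 1ℝ -ₛ 1ₛ) *ₛ t/⟨degExp-1⟩ μ ≈ₛ t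
t/⟨degExp-1⟩-correct μ zero    = R.trans (R.+-identityʳ _) (e0-1*x≈0 μ (t/⟨degExp-1⟩ μ 0))
t/⟨degExp-1⟩-correct μ (suc n) = begin
  (e 0 - 1ℝ) * q (suc n) + ∑[ i ≤ n ] ((e (suc (toℕ i)) - 0ℝ) * q (n ∸ toℕ i))
    ≈⟨ R.+-cong (e0-1*x≈0 μ (q (suc n)))
         (sum-cong-≋ {suc n} λ i → R.*-congʳ {q (n ∸ toℕ i)} (x-0≈x (e (suc (toℕ i))))) ⟩
  0ℝ + ∑[ i ≤ n ] (e (suc (toℕ i)) * q (n ∸ toℕ i))
    ≈⟨ R.+-identityˡ _ ⟩
  ((λ k → e (suc k)) *ₛ q) n
    ≈⟨ reciprocal-inverseʳ (λ k → e (suc k)) (e1≈1 μ) n ⟩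
  1ₛ n ∎
  where
  e q : Series
  e = degExp μ 1ℝ
  q = t/⟨degExp-1⟩ μ

-- β_{n,μ}(x), from t/(e_μ(t)-1) e_μ^x(t) = ∑ β_{n,μ}(x) tⁿ/n!
degBernoulli : ℕ → ℝ → ℝ → ℝ
degBernoulli n μ x = fromNat (n !) * (t/⟨degExp-1⟩ μ *ₛ degExp μ x) n

-- H_{n,μ}
degHarmonic : ℕ → (μ : ℝ) → μ # 0ℝ → ℝ
degHarmonic n μ μ#0 = ∑₁ n λ k → μ ⁻¹⟨ μ#0 ⟩ * binomial μ k * (- 1ℝ) ^ (k ∸ 1)

-- S is S_{2,μ}: the defining expansion. It determines S n k for k ≤ n, and leaves the
-- remaining values free.
IsDegStirling₂ : ℝ → (ℕ → ℕ → ℝ) → Set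
IsDegStirling₂ μ S = ∀ n x → degFalling μ x n ≈ ∑₀ n λ k → S n k * falling x k

degStirling₂-exists : ∀ μ → ∃ (IsDegStirling₂ μ)
degStirling₂-exists μ = S , expansion
  where
  c : ℕ → ℕ → ℝ
  c n k = fromNat k - fromNat n * μ

  S : ℕ → ℕ → ℝ
  S zero    zero    = 1ℝ
  S zero    (suc k) = 0ℝ
  S (suc n) zero    = c n 0 * S n 0
  S (suc n) (suc k) = S n k + c n (suc k) * S n (suc k)

  S-zero : ∀ {n k} → n ℕ.< k → S n k ≈ 0ℝ
  S-zero {zero}  {suc k} _         = R.refl
  S-zero {suc n} {suc k} (ℕ.s≤s p) = R.trans
    (R.+-cong (S-zero p) (R.trans (R.*-congˡ (S-zero (ℕ.m<n⇒m<1+n p))) (R.zeroʳ _)))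
    (R.+-identityʳ 0ℝ)

  ∑₀-last : ∀ n (f : ℕ → ℝ) → f (suc n) ≈ 0ℝ → ∑₀ (suc n) f ≈ ∑₀ n f
  ∑₀-last n f f≈0 = begin
    ∑₀ (suc n) f
      ≈⟨ sum-init-last {suc n} (λ i → f (toℕ i)) ⟩
    ∑[ i ≤ n ] f (toℕ (inject₁ i)) + f (toℕ (fromℕ (suc n)))
      ≈⟨ R.+-cong (R.reflexive (sum-cong-≗ {suc n} λ i → ≡.cong f (Fin.toℕ-inject₁ i)))
           (R.trans (R.reflexive (≡.cong f (Fin.toℕ-fromℕ (suc n)))) f≈0) ⟩
    ∑₀ n f + 0ℝ
      ≈⟨ R.+-identityʳ _ ⟩
    ∑₀ n f ∎

  telescope : ∀ a b d → a - d ≈ (a - b) + (b - d)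
  telescope a b d = R.sym (begin
    (a - b) + (b - d)        ≈⟨ R.+-assoc a (- b) (b - d) ⟩
    a + (- b + (b - d))      ≈⟨ R.+-congˡ (R.sym (R.+-assoc (- b) b (- d))) ⟩
    a + ((- b + b) + (- d))  ≈⟨ R.+-congˡ (R.+-congʳ (R.-‿inverseˡ b)) ⟩
    a + (0ℝ + (- d))         ≈⟨ R.+-congˡ (R.+-identityˡ (- d)) ⟩
    a - d                    ∎)

  term : ∀ n x k → S n k * falling x k * (x - fromNat n * μ)
                 ≈ S n k * falling x (suc k) + c n k * S n k * falling x k
  term n x k = begin
    S n k * F * (x - fromNat n * μ)
      ≈⟨ R.*-congˡ (telescope x (fromNat k) (fromNat n * μ)) ⟩
    S n k * F * ((x - fromNat k) + c n k)
      ≈⟨ R.distribˡ (S n k * F) (x - fromNat k) (c n k) ⟩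
    S n k * F * (x - fromNat k) + S n k * F * c n k
      ≈⟨ R.+-cong (R.*-assoc (S n k) F (x - fromNat k))
           (R.trans (R.*-comm (S n k * F) (c n k)) (R.sym (R.*-assoc (c n k) (S n k) F))) ⟩
    S n k * (F * (x - fromNat k)) + c n k * S n k * F ∎
    where F = falling x k

  expansion : IsDegStirling₂ μ S
  expansion zero    x = R.sym (R.trans (R.+-identityʳ _) (R.*-identityʳ 1ℝ))
  expansion (suc n) x = begin
    degFalling μ x n * (x - fromNat n * μ)
      ≈⟨ R.*-congʳ (expansion n x) ⟩
    ∑₀ n (λ k → S n k * F k) * (x - fromNat n * μ)
      ≈⟨ *-distribʳ-sum {suc n} (x - fromNat n * μ) (λ i → S n (toℕ i) * F (toℕ i)) ⟩
    ∑₀ n (λ k → S n k * F k * (x - fromNat n * μ))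
      ≈⟨ sum-cong-≋ {suc n} (λ i → term n x (toℕ i)) ⟩
    ∑₀ n (λ k → S n k * F (suc k) + C k)
      ≈⟨ ∑-distrib-+ {suc n} (λ i → S n (toℕ i) * F (suc (toℕ i))) (λ i → C (toℕ i)) ⟩
    A + ∑₀ n C
      ≈⟨ R.+-congˡ (R.sym (∑₀-last n C C-last)) ⟩
    A + (C 0 + B)
      ≈⟨ R.+-comm A (C 0 + B) ⟩
    (C 0 + B) + A
      ≈⟨ R.+-assoc (C 0) B A ⟩
    C 0 + (B + A)
      ≈⟨ R.+-congˡ (R.+-comm B A) ⟩
    C 0 + (A + B)
      ≈⟨ R.+-congˡ (R.sym (∑-distrib-+ {suc n} (λ i → S n (toℕ i) * F (suc (toℕ i)))
                                               (λ i → C (suc (toℕ i))))) ⟩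
    C 0 + ∑₀ n (λ k → S n k * F (suc k) + C (suc k))
      ≈⟨ R.+-congˡ (sum-cong-≋ {suc n} λ i → R.sym (R.distribʳ (F (suc (toℕ i)))
           (S n (toℕ i)) (c n (suc (toℕ i)) * S n (suc (toℕ i))))) ⟩
    ∑₀ (suc n) (λ k → S (suc n) k * F k) ∎
    where
    F C : ℕ → ℝ
    F = falling x
    C k = c n k * S n k * F k
    A = ∑₀ n λ k → S n k * F (suc k)
    B = ∑₀ n λ k → C (suc k)

    C-last : C (suc n) ≈ 0ℝ
    C-last = begin
      c n (suc n) * S n (suc n) * F (suc n)  ≈⟨ R.*-congʳ (R.*-congˡ (S-zero (ℕ.n<1+n n))) ⟩
      c n (suc n) * 0ℝ * F (suc n)           ≈⟨ R.*-congʳ (R.zeroʳ _) ⟩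
      0ℝ * F (suc n)                         ≈⟨ R.zeroˡ _ ⟩
      0ℝ                                     ∎

{-# OPTIONS --safe #-}

-- With μ = -λ, let u = 1 - 1/e_μ(t). The operator θ = (1 + μt) d/dt is a derivation with
-- θ e_μ^x = x e_μ^x and θ u = 1 - u, and an eigenvector of θ is determined by its eigenvalue and
-- constant term. Hence ∑ (-1)^k C(x,k) u^k = e_μ^{-x}(t), and reading this as an expansion in
-- falling factorials of x gives S_{2,λ}(n,k) = (-1)^{n-k} (n!/k!) [t^n] u^k. The right-hand side
-- is therefore n! [t^n] F for F = ∑ (H_k/k) u^k. Now θ F = ∑ (H_{k+1} - H_k) u^k, so
-- u θ F = (1 - (1 - u)^μ)/μ = t e_μ^{-μ}(t). Since θ F = e_μ^μ F′ and e_μ(t) u = e_μ(t) - 1,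
-- this says (e_μ(t) - 1) F′ = t e_μ^{1-2μ}(t).

module Submission where

open import Defs
open import Algebra.Bundles using (CommutativeRing)
open import Algebra.Solver.Ring.AlmostCommutativeRing using (fromCommutativeRing; _-Raw-AlmostCommutative⟶_)
import Algebra.Solver.CommutativeMonoid as MonoidSolver
import Algebra.Solver.Ring as RingSolver
open import Data.Fin.Base using (toℕ; fromℕ; inject₁)
import Data.Fin.Properties as Fin
open import Data.Integer.Base as ℤ using (+_)
import Data.Integer.Properties as ℤ
open import Data.Maybe.Base using (Maybe; just; nothing)
open import Data.Nat.Base as ℕ using (ℕ; zero; suc; _≤_; _<_; _∸_; _!; s≤s)
import Data.Nat.Properties as ℕ
open import Data.Product.Base using (_,_)
open import Data.Rational.Base as ℚ using (ℚ; 0ℚ; 1ℚ; toℚᵘ)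
import Data.Rational.Properties as ℚ
open import Data.Rational.Unnormalised.Base as ℚᵘ using (mkℚᵘ; *≡*)
import Data.Rational.Unnormalised.Properties as ℚᵘ
open import Function.Base using (_∘_)
open import Level using (0ℓ)
open import Relation.Binary.PropositionalEquality as ≡ using (_≡_)
open import Relation.Nullary using (yes; no)

private
  module R = CommutativeRing ℝ-commutativeRing

open import Algebra.Properties.Ring R.ring using (-0#≈0#; +-cancelˡ)
open import Algebra.Properties.Semiring.Exp R.semiring using (^-homo-*; ^-congʳ)
open import Algebra.Properties.Semiring.Sum R.semiring
  using (sum-syntax; sum-cong-≋; sum-cong-≗; sum-init-last; sum-replicate-zero;
         ∑-distrib-+; ∑-comm; *-distribˡ-sum)
open import Relation.Binary.Reasoning.Setoid R.setoid

-- A ring solver over the reals with rational constants.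

private
  fromℚ-morphism : ℚ.+-*-rawRing -Raw-AlmostCommutative⟶ fromCommutativeRing ℝ-commutativeRing
  fromℚ-morphism = record
    { ⟦_⟧    = fromℚ
    ; +-homo = fromℚ-+
    ; *-homo = fromℚ-*
    ; -‿homo = λ _ → pointwise λ _ → ≡.refl
    ; 0-homo = R.refl
    ; 1-homo = R.refl
    }

  fromℚ-≟ : ∀ p q → Maybe (fromℚ p ≈ fromℚ q)
  fromℚ-≟ p q with p ℚ.≟ q
  ... | yes p≡q = just (R.reflexive (≡.cong fromℚ p≡q))
  ... | no  _   = nothing

open RingSolver ℚ.+-*-rawRing (fromCommutativeRing ℝ-commutativeRing) fromℚ-morphism fromℚ-≟
  using (solve; con; _:+_; _:*_; _:-_; :-_; _:=_)

-- Natural numbers and factorials in ℝ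

-- Division in `ℚ` normalises by a gcd and does not reduce for a variable `n`, so the comparison is
-- made in the unnormalised rationals.
fromNat-suc : ∀ n → fromNat (suc n) ≈ 1ℝ + fromNat n
fromNat-suc n = pointwise λ _ → ℚ.toℚᵘ-injective (ℚᵘ.≃-trans
  (ℚ.toℚᵘ-fromℚᵘ (mkℚᵘ (+ suc n) 0)) (ℚᵘ.≃-sym (ℚᵘ.≃-trans
  (ℚ.toℚᵘ-homo-+ 1ℚ (+ n ℚ./ 1)) (ℚᵘ.≃-trans
  (ℚᵘ.+-congʳ (toℚᵘ 1ℚ) (ℚ.toℚᵘ-fromℚᵘ (mkℚᵘ (+ n) 0)))
  (*≡* (≡.cong (λ i → (+ 1 ℤ.+ i) ℤ.* + 1) (ℤ.*-identityʳ (+ n))))))))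

fromNat-* : ∀ m n → fromNat (m ℕ.* n) ≈ fromNat m * fromNat n
fromNat-* zero    n = R.sym (R.zeroˡ (fromNat n))
fromNat-* (suc m) n = begin
  fromNat (n ℕ.+ m ℕ.* n)              ≈⟨ fromNat-+ n (m ℕ.* n) ⟩
  fromNat n + fromNat (m ℕ.* n)        ≈⟨ R.+-congˡ (fromNat-* m n) ⟩
  fromNat n + fromNat m * fromNat n    ≈⟨ solve 2 (λ m n → n :+ m :* n := (con 1ℚ :+ m) :* n) R.refl (fromNat m) (fromNat n) ⟩
  (1ℝ + fromNat m) * fromNat n         ≈⟨ R.*-congʳ (fromNat-suc m) ⟨
  fromNat (suc m) * fromNat n          ∎
  where
  fromNat-+ : ∀ m n → fromNat (m ℕ.+ n) ≈ fromNat m + fromNat n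
  fromNat-+ zero    n = R.sym (R.+-identityˡ (fromNat n))
  fromNat-+ (suc m) n = begin
    fromNat (suc (m ℕ.+ n))        ≈⟨ fromNat-suc (m ℕ.+ n) ⟩
    1ℝ + fromNat (m ℕ.+ n)         ≈⟨ R.+-congˡ (fromNat-+ m n) ⟩
    1ℝ + (fromNat m + fromNat n)   ≈⟨ R.+-assoc 1ℝ (fromNat m) (fromNat n) ⟨
    1ℝ + fromNat m + fromNat n     ≈⟨ R.+-congʳ (fromNat-suc m) ⟨
    fromNat (suc m) + fromNat n    ∎

!*1/! : ∀ k → fromNat (k !) * 1/ k ! ≈ 1ℝ
!*1/! k = pointwise λ _ → n*1/n (k !) {{k ℕ.!≢0}}
  where
  n*1/n : ∀ n .{{_ : ℕ.NonZero n}} → (+ n ℚ./ 1) ℚ.* (+ 1 ℚ./ n) ≡ 1ℚ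
  n*1/n (suc n) = ℚ.toℚᵘ-injective (ℚᵘ.≃-trans
    (ℚ.toℚᵘ-homo-* (+ suc n ℚ./ 1) (+ 1 ℚ./ suc n)) (ℚᵘ.≃-trans
    (ℚᵘ.*-cong (ℚ.toℚᵘ-fromℚᵘ (mkℚᵘ (+ suc n) 0)) (ℚ.toℚᵘ-fromℚᵘ (mkℚᵘ (+ 1) n)))
    (*≡* (≡.trans (ℤ.*-comm (+ suc n ℤ.* + 1) (+ 1)) (≡.cong (+ 1 ℤ.*_) (ℤ.*-comm (+ suc n) (+ 1)))))))

suc*1/! : ∀ k → fromNat (suc k) * 1/ suc k ! ≈ 1/ k !
suc*1/! k = begin
  s * i′                    ≈⟨ R.*-identityʳ _ ⟨
  s * i′ * 1ℝ               ≈⟨ R.*-congˡ (!*1/! k) ⟨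
  s * i′ * (k! * i)         ≈⟨ solve 4 (λ s i′ k! i → s :* i′ :* (k! :* i) := s :* k! :* i′ :* i) R.refl s i′ k! i ⟩
  s * k! * i′ * i           ≈⟨ R.*-congʳ (R.*-congʳ (fromNat-* (suc k) (k !))) ⟨
  fromNat (suc k !) * i′ * i  ≈⟨ R.*-congʳ (!*1/! (suc k)) ⟩
  1ℝ * i                    ≈⟨ R.*-identityˡ i ⟩
  i                         ∎
  where
  s  = fromNat (suc k)
  k! = fromNat (k !)
  i  = 1/ k !
  i′ = 1/ suc k !

-- The number `k ! * 1/ suc k !` is an inverse of `k + 1`, so factorials alone supply the division.
suc-cancel : ∀ k {x y} → fromNat (suc k) * x ≈ fromNat (suc k) * y → x ≈ y
suc-cancel k {x} {y} p = begin
  x            ≈⟨ unscale x ⟩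
  j * (s * x)  ≈⟨ R.*-congˡ p ⟩
  j * (s * y)  ≈⟨ unscale y ⟨
  y            ∎
  where
  s = fromNat (suc k)
  j = fromNat (k !) * 1/ suc k !
  unscale : ∀ x → x ≈ j * (s * x)
  unscale x = begin
    x                                        ≈⟨ R.*-identityˡ x ⟨
    1ℝ * x                                   ≈⟨ R.*-congʳ (!*1/! k) ⟨
    fromNat (k !) * 1/ k ! * x               ≈⟨ R.*-congʳ (R.*-congˡ (suc*1/! k)) ⟨
    fromNat (k !) * (s * 1/ suc k !) * x     ≈⟨ solve 4 (λ a s i x → a :* (s :* i) :* x := a :* i :* (s :* x)) R.refl (fromNat (k !)) s (1/ suc k !) x ⟩
    j * (s * x)                              ∎

-- Finite sums

∑< : ℕ → (ℕ → ℝ) → ℝ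
∑< n f = ∑[ i < n ] f (toℕ i)

∑<-cong : ∀ n {f g} → (∀ k → k < n → f k ≈ g k) → ∑< n f ≈ ∑< n g
∑<-cong n f≈g = sum-cong-≋ {n} λ i → f≈g (toℕ i) (Fin.toℕ<n i)

∑<-zero : ∀ n {f} → (∀ k → k < n → f k ≈ 0ℝ) → ∑< n f ≈ 0ℝ
∑<-zero n f≈0 = R.trans (∑<-cong n f≈0) (sum-replicate-zero n)

∑<-+ : ∀ n f g → ∑< n (λ k → f k + g k) ≈ ∑< n f + ∑< n g
∑<-+ n f g = ∑-distrib-+ {n} (f ∘ toℕ) (g ∘ toℕ)

∑<-*ˡ : ∀ n c f → c * ∑< n f ≈ ∑< n (λ k → c * f k)
∑<-*ˡ n c f = *-distribˡ-sum {n} c (f ∘ toℕ)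

∑<-last : ∀ n f → ∑< (suc n) f ≈ ∑< n f + f n
∑<-last n f = begin
  ∑< (suc n) f
    ≈⟨ sum-init-last {n} (f ∘ toℕ) ⟩
  ∑[ i < n ] f (toℕ (inject₁ i)) + f (toℕ (fromℕ n))
    ≈⟨ R.+-cong (R.reflexive (sum-cong-≗ {n} λ i → ≡.cong f (Fin.toℕ-inject₁ i)))
                (R.reflexive (≡.cong f (Fin.toℕ-fromℕ n))) ⟩
  ∑< n f + f n ∎

-- The ring of formal power series

infix 4 _≋_

-- _≈ₛ_ as a record, so that both sides can be inferred.
record _≋_ (f g : Series) : Set where
  constructor mk≋
  field at : f ≈ₛ g

open _≋_

infixl 6 _+ₛ_
infixr 7 _∙_

_+ₛ_ : Series → Series → Series
(f +ₛ g) n = f n + g n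

-ₛ_ tail : Series → Series
(-ₛ f) n = - f n
tail f n = f (suc n)

_∙_ : ℝ → Series → Series
(c ∙ f) n = c * f n

0ₛ : Series
0ₛ _ = 0ℝ

*ₛ-cong : ∀ {f f′ g g′} → f ≈ₛ f′ → g ≈ₛ g′ → f *ₛ g ≈ₛ f′ *ₛ g′
*ₛ-cong f≈f′ g≈g′ n = ∑<-cong (suc n) λ k _ → R.*-cong (f≈f′ k) (g≈g′ (n ∸ k))

*ₛ-distribʳ : ∀ h f g → (f +ₛ g) *ₛ h ≈ₛ f *ₛ h +ₛ g *ₛ h
*ₛ-distribʳ h f g n = R.trans
  (∑<-cong (suc n) λ k _ → R.distribʳ (h (n ∸ k)) (f k) (g k))
  (∑<-+ (suc n) (λ k → f k * h (n ∸ k)) (λ k → g k * h (n ∸ k)))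

∙-*ₛ : ∀ c f g → (c ∙ f) *ₛ g ≈ₛ c ∙ (f *ₛ g)
∙-*ₛ c f g n = R.sym (R.trans (∑<-*ˡ (suc n) c (λ k → f k * g (n ∸ k)))
  (∑<-cong (suc n) λ k _ → R.sym (R.*-assoc c (f k) (g (n ∸ k)))))

*ₛ-zeroˡ : ∀ f → 0ₛ *ₛ f ≈ₛ 0ₛ
*ₛ-zeroˡ f n = ∑<-zero (suc n) λ k _ → R.zeroˡ (f (n ∸ k))

*ₛ-identityˡ : ∀ f → 1ₛ *ₛ f ≈ₛ f
*ₛ-identityˡ f zero    = R.trans (R.+-identityʳ _) (R.*-identityˡ (f 0))
*ₛ-identityˡ f (suc n) = begin
  1ℝ * f (suc n) + (0ₛ *ₛ f) n  ≈⟨ R.+-cong (R.*-identityˡ (f (suc n))) (*ₛ-zeroˡ f n) ⟩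
  f (suc n) + 0ℝ                ≈⟨ R.+-identityʳ (f (suc n)) ⟩
  f (suc n)                     ∎

-- By computation a product loses the head of its left factor. Losing the head of the right factor
-- instead is what the induction for commutativity needs.
*ₛ-suc′ : ∀ f g n → (f *ₛ g) (suc n) ≈ f (suc n) * g 0 + (f *ₛ tail g) n
*ₛ-suc′ f g zero    = solve 4 (λ a b c d → a :* d :+ (b :* c :+ con 0ℚ) := b :* c :+ (a :* d :+ con 0ℚ))
  R.refl (f 0) (f 1) (g 0) (g 1)
*ₛ-suc′ f g (suc n) = begin
  f 0 * g (suc (suc n)) + (tail f *ₛ g) (suc n)
    ≈⟨ R.+-congˡ (*ₛ-suc′ (tail f) g n) ⟩
  f 0 * g (suc (suc n)) + (f (suc (suc n)) * g 0 + (tail f *ₛ tail g) n)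
    ≈⟨ solve 3 (λ a b c → a :+ (b :+ c) := b :+ (a :+ c)) R.refl _ _ _ ⟩
  f (suc (suc n)) * g 0 + (f 0 * g (suc (suc n)) + (tail f *ₛ tail g) n) ∎

*ₛ-comm : ∀ f g → f *ₛ g ≈ₛ g *ₛ f
*ₛ-comm f g zero    = R.+-congʳ (R.*-comm (f 0) (g 0))
*ₛ-comm f g (suc n) = begin
  f 0 * g (suc n) + (tail f *ₛ g) n  ≈⟨ R.+-cong (R.*-comm (f 0) (g (suc n))) (*ₛ-comm (tail f) g n) ⟩
  g (suc n) * f 0 + (g *ₛ tail f) n  ≈⟨ *ₛ-suc′ g f n ⟨
  (g *ₛ f) (suc n)                   ∎

-- Induction on the coefficient index: `tail (f *ₛ g)` is by computation
-- `f 0 ∙ tail g +ₛ tail f *ₛ g`, so distributivity reduces the claim to `tail f`.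
*ₛ-assoc : ∀ f g h → (f *ₛ g) *ₛ h ≈ₛ f *ₛ (g *ₛ h)
*ₛ-assoc f g h zero    = solve 3 (λ a b c → (a :* b :+ con 0ℚ) :* c :+ con 0ℚ := a :* (b :* c :+ con 0ℚ) :+ con 0ℚ)
  R.refl (f 0) (g 0) (h 0)
*ₛ-assoc f g h (suc n) = begin
  (f 0 * g 0 + 0ℝ) * h (suc n) + (tail (f *ₛ g) *ₛ h) n
    ≈⟨ R.+-congˡ (*ₛ-distribʳ h (f 0 ∙ tail g) (tail f *ₛ g) n) ⟩
  (f 0 * g 0 + 0ℝ) * h (suc n) + (((f 0 ∙ tail g) *ₛ h) n + ((tail f *ₛ g) *ₛ h) n)
    ≈⟨ R.+-congˡ (R.+-cong (∙-*ₛ (f 0) (tail g) h n) (*ₛ-assoc (tail f) g h n)) ⟩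
  (f 0 * g 0 + 0ℝ) * h (suc n) + (f 0 * (tail g *ₛ h) n + (tail f *ₛ (g *ₛ h)) n)
    ≈⟨ solve 5 (λ a b c d e → (a :* b :+ con 0ℚ) :* c :+ (a :* d :+ e) := a :* (b :* c :+ d) :+ e)
         R.refl (f 0) (g 0) (h (suc n)) _ _ ⟩
  f 0 * (g *ₛ h) (suc n) + (tail f *ₛ (g *ₛ h)) n ∎

*ₛ-identityʳ : ∀ f → f *ₛ 1ₛ ≈ₛ f
*ₛ-identityʳ f n = R.trans (*ₛ-comm f 1ₛ n) (*ₛ-identityˡ f n)

*ₛ-distribˡ : ∀ h f g → h *ₛ (f +ₛ g) ≈ₛ h *ₛ f +ₛ h *ₛ g
*ₛ-distribˡ h f g n = R.trans (*ₛ-comm h (f +ₛ g) n)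
  (R.trans (*ₛ-distribʳ h f g n) (R.+-cong (*ₛ-comm f h n) (*ₛ-comm g h n)))

series-commutativeRing : CommutativeRing 0ℓ 0ℓ
series-commutativeRing = record
  { Carrier = Series
  ; _≈_ = _≋_
  ; _+_ = _+ₛ_
  ; _*_ = _*ₛ_
  ; -_ = -ₛ_
  ; 0# = 0ₛ
  ; 1# = 1ₛ
  ; isCommutativeRing = record
    { isRing = record
      { +-isAbelianGroup = record
        { isGroup = record
          { isMonoid = record
            { isSemigroup = record
              { isMagma = record
                { isEquivalence = record
                  { refl  = mk≋ λ _ → R.refl
                  ; sym   = λ p → mk≋ λ n → R.sym (at p n)
                  ; trans = λ p q → mk≋ λ n → R.trans (at p n) (at q n)
                  }
                ; ∙-cong = λ p q → mk≋ λ n → R.+-cong (at p n) (at q n)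
                }
              ; assoc = λ f g h → mk≋ λ n → R.+-assoc (f n) (g n) (h n)
              }
            ; identity = (λ f → mk≋ λ n → R.+-identityˡ (f n)) , λ f → mk≋ λ n → R.+-identityʳ (f n)
            }
          ; inverse = (λ f → mk≋ λ n → R.-‿inverseˡ (f n)) , λ f → mk≋ λ n → R.-‿inverseʳ (f n)
          ; ⁻¹-cong = λ p → mk≋ λ n → R.-‿cong (at p n)
          }
        ; comm = λ f g → mk≋ λ n → R.+-comm (f n) (g n)
        }
      ; *-cong = λ p q → mk≋ (*ₛ-cong (at p) (at q))
      ; *-assoc = λ f g h → mk≋ (*ₛ-assoc f g h)
      ; *-identity = (λ f → mk≋ (*ₛ-identityˡ f)) , λ f → mk≋ (*ₛ-identityʳ f)
      ; distrib = (λ h f g → mk≋ (*ₛ-distribˡ h f g)) , λ h f g → mk≋ (*ₛ-distribʳ h f g)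
      }
    ; *-comm = λ f g → mk≋ (*ₛ-comm f g)
    }
  }

private
  module S = CommutativeRing series-commutativeRing
  module SP where
    open import Algebra.Properties.Ring S.ring public using (x[y-z]≈xy-xz; [y-z]x≈yx-zx)
  module SR where
    open import Relation.Binary.Reasoning.Setoid S.setoid public

*ₛ-∙ : ∀ c f g → f *ₛ (c ∙ g) ≋ c ∙ (f *ₛ g)
*ₛ-∙ c f g = mk≋ λ n → R.trans (*ₛ-comm f (c ∙ g) n)
  (R.trans (∙-*ₛ c g f n) (R.*-congˡ (*ₛ-comm g f n)))

∙-cong : ∀ {c d f g} → c ≈ d → f ≋ g → c ∙ f ≋ d ∙ g
∙-cong c≈d f≋g = mk≋ λ n → R.*-cong c≈d (at f≋g n)

t*ₛ-suc : ∀ f n → (t *ₛ f) (suc n) ≈ f n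
t*ₛ-suc f n = begin
  0ℝ * f (suc n) + (1ₛ *ₛ f) n  ≈⟨ R.+-cong (R.zeroˡ (f (suc n))) (*ₛ-identityˡ f n) ⟩
  0ℝ + f n                      ≈⟨ R.+-identityˡ (f n) ⟩
  f n                           ∎

-- Derivations

-- These are d/dt and t d/dt, and `∂ f` is the tail of `euler f` by computation. Both are also
-- applied to coefficient sequences in powers of `u`.
∂ euler : Series → Series
∂ f n     = fromNat (suc n) * f (suc n)
euler f n = fromNat n * f n

-- The Leibniz rule comes first for t d/dt because this operator preserves degree: the weight `n` of
-- a coefficient is shared between the two factors, and induction on tails works.
euler-* : ∀ f g → euler (f *ₛ g) ≈ₛ euler f *ₛ g +ₛ f *ₛ euler g
euler-* f g zero    = solve 2
  (λ a b → con 0ℚ :* (a :* b :+ con 0ℚ) := (con 0ℚ :* a :* b :+ con 0ℚ) :+ (a :* (con 0ℚ :* b) :+ con 0ℚ))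
  R.refl (f 0) (g 0)
euler-* f g (suc n) = begin
  s * (f 0 * g (suc n) + X)
    ≈⟨ R.*-congʳ (fromNat-suc n) ⟩
  (1ℝ + m) * (f 0 * g (suc n) + X)
    ≈⟨ solve 4 (λ m a b x → (con 1ℚ :+ m) :* (a :* b :+ x) := a :* ((con 1ℚ :+ m) :* b) :+ x :+ m :* x)
         R.refl m (f 0) (g (suc n)) X ⟩
  f 0 * ((1ℝ + m) * g (suc n)) + X + m * X
    ≈⟨ R.+-cong (R.+-congʳ (R.*-congˡ (R.*-congʳ (R.sym (fromNat-suc n))))) (euler-* (tail f) g n) ⟩
  f 0 * (s * g (suc n)) + X + (Y + Z)
    ≈⟨ solve 6 (λ a b c x y z → a :* b :+ x :+ (y :+ z) := (con 0ℚ :* a :* c :+ (x :+ y)) :+ (a :* b :+ z))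
         R.refl (f 0) (s * g (suc n)) (g (suc n)) X Y Z ⟩
  (0ℝ * f 0 * g (suc n) + (X + Y)) + (f 0 * (s * g (suc n)) + Z)
    ≈⟨ R.+-congʳ (R.+-congˡ (R.trans (R.sym (*ₛ-distribʳ g (tail f) (euler (tail f)) n))
         (*ₛ-cong {g = g} (λ k → R.sym (tail-euler k)) (λ _ → R.refl) n))) ⟩
  (euler f *ₛ g +ₛ f *ₛ euler g) (suc n) ∎
  where
  s = fromNat (suc n)
  m = fromNat n
  X = (tail f *ₛ g) n
  Y = (euler (tail f) *ₛ g) n
  Z = (tail f *ₛ euler g) n
  tail-euler : tail (euler f) ≈ₛ tail f +ₛ euler (tail f)
  tail-euler k = R.trans (R.*-congʳ (fromNat-suc k))
    (solve 2 (λ k a → (con 1ℚ :+ k) :* a := a :+ k :* a) R.refl (fromNat k) (f (suc k)))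

-- This is the coefficient `n + 1` of `euler-*`; the head terms of `euler f` and `euler g` carry a
-- factor 0 and drop out.
∂-* : ∀ f g → ∂ (f *ₛ g) ≋ ∂ f *ₛ g +ₛ f *ₛ ∂ g
∂-* f g = mk≋ λ n → begin
  euler (f *ₛ g) (suc n)
    ≈⟨ euler-* f g (suc n) ⟩
  (euler f *ₛ g) (suc n) + (f *ₛ euler g) (suc n)
    ≈⟨ R.+-congˡ (*ₛ-comm f (euler g) (suc n)) ⟩
  (0ℝ * f 0 * g (suc n) + (∂ f *ₛ g) n) + (0ℝ * g 0 * f (suc n) + (∂ g *ₛ f) n)
    ≈⟨ R.+-congˡ (R.+-congˡ (*ₛ-comm (∂ g) f n)) ⟩
  (0ℝ * f 0 * g (suc n) + (∂ f *ₛ g) n) + (0ℝ * g 0 * f (suc n) + (f *ₛ ∂ g) n)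
    ≈⟨ solve 6 (λ a b c d x y → (con 0ℚ :* a :* b :+ x) :+ (con 0ℚ :* c :* d :+ y) := x :+ y)
         R.refl (f 0) (g (suc n)) (g 0) (f (suc n)) _ _ ⟩
  (∂ f *ₛ g) n + (f *ₛ ∂ g) n ∎

degFalling-cong : ∀ μ {x y} → x ≈ y → ∀ n → degFalling μ x n ≈ degFalling μ y n
degFalling-cong μ x≈y zero    = R.refl
degFalling-cong μ x≈y (suc n) = R.*-cong (degFalling-cong μ x≈y n) (R.+-congʳ x≈y)

-- (1 - u) d/du on coefficient sequences
Δ : (ℕ → ℝ) → ℕ → ℝ
Δ a k = fromNat (suc k) * a (suc k) - fromNat k * a k

signedBinomial : ℝ → ℕ → ℝ
signedBinomial x k = binomial x k * (- 1ℝ) ^ k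

-- This ratio of consecutive coefficients of (1 - u)^x makes the sequence an eigenvector of `Δ` with
-- eigenvalue `- x`.
signedBinomial-suc : ∀ x k → fromNat (suc k) * signedBinomial x (suc k) ≈ - (x - fromNat k) * signedBinomial x k
signedBinomial-suc x k = begin
  s * (F * (x - m) * i′ * (- 1ℝ * p))
    ≈⟨ solve 6 (λ s F x m i′ p → s :* (F :* (x :- m) :* i′ :* (:- con 1ℚ :* p)) := :- (x :- m) :* (F :* (s :* i′) :* p))
         R.refl s F x m i′ p ⟩
  - (x - m) * (F * (s * i′) * p)
    ≈⟨ R.*-congˡ (R.*-congʳ (R.*-congˡ (suc*1/! k))) ⟩
  - (x - m) * (F * 1/ k ! * p) ∎
  where
  s  = fromNat (suc k)
  m  = fromNat k
  F  = falling x k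
  i′ = 1/ suc k !
  p  = (- 1ℝ) ^ k

-- Degenerate exponentials as eigenvectors of a derivation.

module _ (μ : ℝ) where

  degExp-cong : ∀ {x y} → x ≈ y → degExp μ x ≋ degExp μ y
  degExp-cong x≈y = mk≋ λ n → R.*-congʳ (degFalling-cong μ x≈y n)

  -- (1 + μt) d/dt
  θ : Series → Series
  θ f n = ∂ f n + fromNat n * μ * f n

  θ-cong : ∀ {f g} → f ≋ g → θ f ≋ θ g
  θ-cong f≋g = mk≋ λ n → R.+-cong (R.*-congˡ (at f≋g (suc n))) (R.*-congˡ (at f≋g n))

  -- The series e_μ^μ(t) is 1 + μt: from degree 2 on, `degFalling μ μ` contains the factor μ - μ.
  tail-degExp-self : tail (degExp μ μ) ≈ₛ μ ∙ 1ₛ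
  tail-degExp-self zero    = solve 1 (λ μ → con 1ℚ :* (μ :- con 0ℚ :* μ) :* con 1ℚ := μ :* con 1ℚ) R.refl μ
  tail-degExp-self (suc n) = R.trans (R.*-congʳ (vanishes n)) (R.trans (R.zeroˡ _) (R.sym (R.zeroʳ μ)))
    where
    vanishes : ∀ n → degFalling μ μ (suc (suc n)) ≈ 0ℝ
    vanishes zero    = solve 1 (λ μ → con 1ℚ :* (μ :- con 0ℚ :* μ) :* (μ :- con 1ℚ :* μ) := con 0ℚ) R.refl μ
    vanishes (suc n) = R.trans (R.*-congʳ (vanishes n)) (R.zeroˡ _)

  -- Writing 1 + μt as e_μ^μ(t) lets `θ` inherit the Leibniz rule from `∂` and later turns it back
  -- into an ordinary derivative.
  θ≋degExp*∂ : ∀ f → θ f ≋ degExp μ μ *ₛ ∂ f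
  θ≋degExp*∂ f = mk≋ λ where
    zero    → solve 3 (λ d μ a → d :+ con 0ℚ :* μ :* a := con 1ℚ :* con 1ℚ :* d :+ con 0ℚ) R.refl (∂ f 0) μ (f 0)
    (suc n) → begin
      ∂ f (suc n) + fromNat (suc n) * μ * f (suc n)
        ≈⟨ solve 4 (λ d s μ a → d :+ s :* μ :* a := con 1ℚ :* con 1ℚ :* d :+ μ :* (s :* a))
             R.refl (∂ f (suc n)) (fromNat (suc n)) μ (f (suc n)) ⟩
      1ℝ * 1ℝ * ∂ f (suc n) + μ * ∂ f n
        ≈⟨ R.+-congˡ (R.*-congˡ (*ₛ-identityˡ (∂ f) n)) ⟨
      1ℝ * 1ℝ * ∂ f (suc n) + μ * (1ₛ *ₛ ∂ f) n
        ≈⟨ R.+-congˡ (∙-*ₛ μ 1ₛ (∂ f) n) ⟨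
      1ℝ * 1ℝ * ∂ f (suc n) + ((μ ∙ 1ₛ) *ₛ ∂ f) n
        ≈⟨ R.+-congˡ (*ₛ-cong {g = ∂ f} tail-degExp-self (λ _ → R.refl) n) ⟨
      (degExp μ μ *ₛ ∂ f) (suc n) ∎

  θ-* : ∀ f g → θ (f *ₛ g) ≋ θ f *ₛ g +ₛ f *ₛ θ g
  θ-* f g = SR.begin
    θ (f *ₛ g)                               SR.≈⟨ θ≋degExp*∂ (f *ₛ g) ⟩
    B *ₛ ∂ (f *ₛ g)                          SR.≈⟨ S.*-congˡ {B} (∂-* f g) ⟩
    B *ₛ (∂ f *ₛ g +ₛ f *ₛ ∂ g)              SR.≈⟨ S.distribˡ B (∂ f *ₛ g) (f *ₛ ∂ g) ⟩
    B *ₛ (∂ f *ₛ g) +ₛ B *ₛ (f *ₛ ∂ g)       SR.≈⟨ S.+-cong (S.sym (S.*-assoc B (∂ f) g)) swap ⟩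
    B *ₛ ∂ f *ₛ g +ₛ f *ₛ (B *ₛ ∂ g)         SR.≈⟨ S.+-cong (S.*-congʳ {g} (θ≋degExp*∂ f)) (S.*-congˡ {f} (θ≋degExp*∂ g)) ⟨
    θ f *ₛ g +ₛ f *ₛ θ g                     SR.∎
    where
    B = degExp μ μ
    swap : B *ₛ (f *ₛ ∂ g) ≋ f *ₛ (B *ₛ ∂ g)
    swap = S.trans (S.sym (S.*-assoc B f (∂ g))) (S.trans (S.*-congʳ {∂ g} (S.*-comm B f)) (S.*-assoc f B (∂ g)))

  θ-1 : θ 1ₛ ≋ 0ₛ
  θ-1 = mk≋ λ where
    zero    → solve 1 (λ μ → con 1ℚ :* con 0ℚ :+ con 0ℚ :* μ :* con 1ℚ := con 0ℚ) R.refl μ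
    (suc n) → solve 3 (λ a b μ → a :* con 0ℚ :+ b :* μ :* con 0ℚ := con 0ℚ)
                R.refl (fromNat (suc (suc n))) (fromNat (suc n)) μ

  -- The eigenvalue equation is the recursion (n+1) f_{n+1} = (c - nμ) f_n, and n+1 can be
  -- cancelled.
  eigenvector-unique : ∀ {c f g} → f 0 ≈ g 0 → θ f ≋ c ∙ f → θ g ≋ c ∙ g → f ≋ g
  eigenvector-unique {c} {f} {g} f0≈g0 θf θg = mk≋ go
    where
    step : ∀ {h} n → θ h ≋ c ∙ h → fromNat (suc n) * h (suc n) ≈ c * h n - fromNat n * μ * h n
    step {h} n θh = begin
      ∂ h n                              ≈⟨ solve 2 (λ a b → a := (a :+ b) :- b) R.refl (∂ h n) b ⟩
      θ h n - b                          ≈⟨ R.+-congʳ (at θh n) ⟩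
      c * h n - b                        ∎
      where b = fromNat n * μ * h n
    go : f ≈ₛ g
    go zero    = f0≈g0
    go (suc n) = suc-cancel n (begin
      ∂ f n                              ≈⟨ step n θf ⟩
      c * f n - fromNat n * μ * f n      ≈⟨ R.+-cong (R.*-congˡ (go n)) (R.-‿cong (R.*-congˡ (go n))) ⟩
      c * g n - fromNat n * μ * g n      ≈⟨ step n θg ⟨
      ∂ g n                              ∎)

  θ-degExp : ∀ x → θ (degExp μ x) ≋ x ∙ degExp μ x
  θ-degExp x = mk≋ λ n →
    let d = degFalling μ x n; k = fromNat n; s = fromNat (suc n); i = 1/ n !; i′ = 1/ suc n ! in begin
    s * (d * (x - k * μ) * i′) + k * μ * (d * i)
      ≈⟨ solve 7 (λ s d x k μ i′ i → s :* (d :* (x :- k :* μ) :* i′) :+ k :* μ :* (d :* i)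
                                   := d :* (x :- k :* μ) :* (s :* i′) :+ k :* μ :* (d :* i))
           R.refl s d x k μ i′ i ⟩
    d * (x - k * μ) * (s * i′) + k * μ * (d * i)
      ≈⟨ R.+-congʳ (R.*-congˡ (suc*1/! n)) ⟩
    d * (x - k * μ) * i + k * μ * (d * i)
      ≈⟨ solve 5 (λ d x k μ i → d :* (x :- k :* μ) :* i :+ k :* μ :* (d :* i) := x :* (d :* i))
           R.refl d x k μ i ⟩
    x * (d * i) ∎

  -- By the Leibniz rule the eigenvalues of the two factors add, and both sides have constant term
  -- 1.
  degExp-+ : ∀ x y → degExp μ x *ₛ degExp μ y ≋ degExp μ (x + y)
  degExp-+ x y = eigenvector-unique {x + y}
    (solve 0 (con 1ℚ :* con 1ℚ :* (con 1ℚ :* con 1ℚ) :+ con 0ℚ := con 1ℚ :* con 1ℚ) R.refl)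
    (SR.begin
      θ (X *ₛ Y)                        SR.≈⟨ θ-* X Y ⟩
      θ X *ₛ Y +ₛ X *ₛ θ Y              SR.≈⟨ S.+-cong (S.*-congʳ {Y} (θ-degExp x)) (S.*-congˡ {X} (θ-degExp y)) ⟩
      (x ∙ X) *ₛ Y +ₛ X *ₛ (y ∙ Y)      SR.≈⟨ S.+-cong (mk≋ (∙-*ₛ x X Y)) (*ₛ-∙ y X Y) ⟩
      x ∙ (X *ₛ Y) +ₛ y ∙ (X *ₛ Y)      SR.≈⟨ mk≋ (λ n → R.distribʳ ((X *ₛ Y) n) x y) ⟨
      (x + y) ∙ (X *ₛ Y)                SR.∎)
    (θ-degExp (x + y))
    where
    X = degExp μ x
    Y = degExp μ y

  degExp-0 : degExp μ 0ℝ ≋ 1ₛ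
  degExp-0 = eigenvector-unique (R.*-identityˡ 1ℝ) (θ-degExp 0ℝ)
    (mk≋ λ n → R.trans (at θ-1 n) (R.sym (R.zeroˡ (1ₛ n))))

  degExp-inverse : ∀ {x y} → x + y ≈ 0ℝ → degExp μ x *ₛ degExp μ y ≋ 1ₛ
  degExp-inverse {x} {y} p = S.trans (degExp-+ x y) (S.trans (degExp-cong p) degExp-0)

  -- Power series in u = 1 - 1/e_μ(t)

  u : Series
  u = 1ₛ +ₛ -ₛ degExp μ (- 1ℝ)

  u^ : ℕ → Series
  u^ zero    = 1ₛ
  u^ (suc k) = u *ₛ u^ k

  u0≈0 : u 0 ≈ 0ℝ
  u0≈0 = solve 0 (con 1ℚ :- con 1ℚ :* con 1ℚ := con 0ℚ) R.refl

  degExp*u : degExp μ 1ℝ *ₛ u ≋ degExp μ 1ℝ +ₛ -ₛ 1ₛ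
  degExp*u = S.trans (SP.x[y-z]≈xy-xz (degExp μ 1ℝ) 1ₛ (degExp μ (- 1ℝ)))
    (S.+-cong (S.*-identityʳ _) (S.-‿cong (degExp-inverse (R.-‿inverseʳ 1ℝ))))

  θ-u : θ u ≋ 1ₛ +ₛ -ₛ u
  θ-u = mk≋ λ n →
    let s = fromNat (suc n); c = fromNat n * μ; e = degExp μ (- 1ℝ) n; e′ = degExp μ (- 1ℝ) (suc n) in begin
    s * (1ₛ (suc n) - e′) + c * (1ₛ n - e)
      ≈⟨ solve 6 (λ s a b c d e → s :* (a :- b) :+ c :* (d :- e) := (s :* a :+ c :* d) :- (s :* b :+ c :* e))
           R.refl s (1ₛ (suc n)) e′ c (1ₛ n) e ⟩
    θ 1ₛ n - θ (degExp μ (- 1ℝ)) n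
      ≈⟨ R.+-cong (at θ-1 n) (R.-‿cong (at (θ-degExp (- 1ℝ)) n)) ⟩
    0ℝ - (- 1ℝ) * e
      ≈⟨ solve 2 (λ a e → con 0ℚ :- (:- con 1ℚ) :* e := a :- (a :- e)) R.refl (1ₛ n) e ⟩
    1ₛ n - (1ₛ n - e) ∎

  -- The power rule θ u^(k+1) = (k+1) u^k θ u, by repeated use of the Leibniz rule, with θ u = 1 - u
  -- inserted.
  θ-u^ : ∀ k → θ (u^ (suc k)) ≋ fromNat (suc k) ∙ (u^ k +ₛ -ₛ u^ (suc k))
  θ-u^ zero    = SR.begin
    θ (u *ₛ 1ₛ)                         SR.≈⟨ θ-cong (S.*-identityʳ u) ⟩
    θ u                                 SR.≈⟨ θ-u ⟩
    1ₛ +ₛ -ₛ u                          SR.≈⟨ S.+-congˡ (S.-‿cong (S.*-identityʳ u)) ⟨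
    1ₛ +ₛ -ₛ (u *ₛ 1ₛ)                  SR.≈⟨ mk≋ (λ n → R.*-identityˡ _) ⟨
    1ℝ ∙ (1ₛ +ₛ -ₛ (u *ₛ 1ₛ))           SR.∎
  θ-u^ (suc k) = SR.begin
    θ (u *ₛ v)                                      SR.≈⟨ θ-* u v ⟩
    θ u *ₛ v +ₛ u *ₛ θ v                            SR.≈⟨ S.+-cong (S.*-congʳ {v} θ-u) (S.*-congˡ {u} (θ-u^ k)) ⟩
    (1ₛ +ₛ -ₛ u) *ₛ v +ₛ u *ₛ (s ∙ (u^ k +ₛ -ₛ v))
      SR.≈⟨ S.+-cong (SP.[y-z]x≈yx-zx v 1ₛ u) (*ₛ-∙ s u (u^ k +ₛ -ₛ v)) ⟩
    (1ₛ *ₛ v +ₛ -ₛ (u *ₛ v)) +ₛ s ∙ (u *ₛ (u^ k +ₛ -ₛ v))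
      SR.≈⟨ S.+-cong (S.+-congʳ (S.*-identityˡ v)) (∙-cong R.refl (SP.x[y-z]≈xy-xz u (u^ k) v)) ⟩
    (v +ₛ -ₛ (u *ₛ v)) +ₛ s ∙ (v +ₛ -ₛ (u *ₛ v))
      SR.≈⟨ mk≋ (λ n → R.trans (R.*-congʳ (fromNat-suc (suc k)))
              (solve 2 (λ s x → (con 1ℚ :+ s) :* x := x :+ s :* x) R.refl s (v n - (u *ₛ v) n))) ⟨
    fromNat (suc (suc k)) ∙ (v +ₛ -ₛ (u *ₛ v))      SR.∎
    where
    s = fromNat (suc k)
    v = u^ (suc k)

  -- Since `u` has constant term 0, its power u^k is divisible by t^k.
  u^-vanishes : ∀ k n → n < k → u^ k n ≈ 0ℝ
  u^-vanishes (suc k) n (s≤s n≤k) = R.trans (R.+-cong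
    (R.trans (R.*-congʳ u0≈0) (R.zeroˡ (u^ k n))) (rest n n≤k)) (R.+-identityˡ 0ℝ)
    where
    rest : ∀ n → n ≤ k → ∑< n (λ i → u (suc i) * u^ k (n ∸ suc i)) ≈ 0ℝ
    rest n n≤k = ∑<-zero n λ i i<n → R.trans (R.*-congˡ (u^-vanishes k (n ∸ suc i)
      (ℕ.<-≤-trans (ℕ.∸-monoʳ-< {n} {suc i} {0} ℕ.z<s i<n) n≤k))) (R.zeroʳ (u (suc i)))

  -- The infinite sum ∑ a_k u^k, cut off at `k = n` because higher powers do not reach t^n.
  eval : (ℕ → ℝ) → Series
  eval a n = ∑< (suc n) λ k → a k * u^ k n

  eval-cong : ∀ {a b} → (∀ k → a k ≈ b k) → eval a ≋ eval b
  eval-cong {a} {b} a≈b = mk≋ λ n →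
    ∑<-cong (suc n) {λ k → a k * u^ k n} {λ k → b k * u^ k n} λ k _ → R.*-congʳ (a≈b k)

  eval-∙ : ∀ c a → eval (λ k → c * a k) ≋ c ∙ eval a
  eval-∙ c a = mk≋ λ n → R.trans (∑<-cong (suc n) λ k _ → R.*-assoc c (a k) (u^ k n))
    (R.sym (∑<-*ˡ (suc n) c λ k → a k * u^ k n))

  -- Coefficients of different degrees come with different cutoffs; adding vanishing terms brings
  -- them to a common range.
  eval-extend : ∀ a n N → n ≤ N → ∑< (suc N) (λ k → a k * u^ k n) ≈ eval a n
  eval-extend a n N n≤N = ≡.subst (λ N → ∑< (suc N) (λ k → a k * u^ k n) ≈ eval a n) (ℕ.m∸n+n≡m n≤N) (go (N ∸ n))
    where
    go : ∀ d → ∑< (suc (d ℕ.+ n)) (λ k → a k * u^ k n) ≈ eval a n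
    go zero    = R.refl
    go (suc d) = begin
      ∑< (suc (suc (d ℕ.+ n))) (λ k → a k * u^ k n)
        ≈⟨ ∑<-last (suc (d ℕ.+ n)) (λ k → a k * u^ k n) ⟩
      ∑< (suc (d ℕ.+ n)) (λ k → a k * u^ k n) + a (suc (d ℕ.+ n)) * u^ (suc (d ℕ.+ n)) n
        ≈⟨ R.+-cong (go d) (R.trans (R.*-congˡ (u^-vanishes (suc (d ℕ.+ n)) n (s≤s (ℕ.m≤n+m n d)))) (R.zeroʳ _)) ⟩
      eval a n + 0ℝ
        ≈⟨ R.+-identityʳ _ ⟩
      eval a n ∎

  -- The power rule is applied term by term, and the u^k part and the u^(k+1) part are then
  -- collected separately.
  θ-eval : ∀ a → θ (eval a) ≋ eval (Δ a)
  θ-eval a = mk≋ λ n → let m = fromNat n * μ; s = fromNat (suc n) in begin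
    s * eval a (suc n) + m * eval a n
      -- The derivative looks one degree higher, so the second sum is given one more term.
      ≈⟨ R.+-congˡ (R.*-congˡ (eval-extend a n (suc n) (ℕ.n≤1+n n))) ⟨
    s * ∑< (suc (suc n)) (λ k → a k * u^ k (suc n)) + m * ∑< (suc (suc n)) (λ k → a k * u^ k n)
      ≈⟨ R.+-cong (∑<-*ˡ (suc (suc n)) s λ k → a k * u^ k (suc n)) (∑<-*ˡ (suc (suc n)) m λ k → a k * u^ k n) ⟩
    ∑< (suc (suc n)) (λ k → s * (a k * u^ k (suc n))) + ∑< (suc (suc n)) (λ k → m * (a k * u^ k n))
      ≈⟨ ∑<-+ (suc (suc n)) (λ k → s * (a k * u^ k (suc n))) (λ k → m * (a k * u^ k n)) ⟨
    ∑< (suc (suc n)) (λ k → s * (a k * u^ k (suc n)) + m * (a k * u^ k n))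
      ≈⟨ ∑<-cong (suc (suc n)) (λ k _ →
           solve 5 (λ s a x m y → s :* (a :* x) :+ m :* (a :* y) := a :* (s :* x :+ m :* y))
             R.refl s (a k) (u^ k (suc n)) m (u^ k n)) ⟩
    a 0 * θ (u^ 0) n + ∑< (suc n) (λ k → a (suc k) * θ (u^ (suc k)) n)
      ≈⟨ R.+-cong (R.trans (R.*-congˡ (at θ-1 n)) (R.zeroʳ (a 0)))
           (∑<-cong (suc n) λ k _ → R.trans (R.*-congˡ (at (θ-u^ k) n))
             (solve 4 (λ a s x y → a :* (s :* (x :- y)) := s :* a :* x :+ :- con 1ℚ :* (s :* a :* y))
               R.refl (a (suc k)) (fromNat (suc k)) (u^ k n) (u^ (suc k) n))) ⟩
    0ℝ + ∑< (suc n) (λ k → b k * u^ k n + - 1ℝ * (b k * u^ (suc k) n))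
      ≈⟨ R.+-congˡ (∑<-+ (suc n) (λ k → b k * u^ k n) λ k → - 1ℝ * (b k * u^ (suc k) n)) ⟩
    0ℝ + (eval b n + ∑< (suc n) (λ k → - 1ℝ * (b k * u^ (suc k) n)))
      ≈⟨ R.+-congˡ (R.+-congˡ (∑<-*ˡ (suc n) (- 1ℝ) λ k → b k * u^ (suc k) n)) ⟨
    0ℝ + (eval b n + - 1ℝ * ∑< (suc n) (λ k → b k * u^ (suc k) n))
      -- A term with `k = 0` and weight 0 is put in front, so that the shifted sum starts at 0
      -- again.
      ≈⟨ solve 4 (λ x y z w → con 0ℚ :+ (x :+ :- con 1ℚ :* y) := x :+ :- con 1ℚ :* (con 0ℚ :* z :* w :+ y))
           R.refl (eval b n) (∑< (suc n) (λ k → b k * u^ (suc k) n)) (a 0) (u^ 0 n) ⟩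
    eval b n + - 1ℝ * ∑< (suc (suc n)) (λ k → euler a k * u^ k n)
      ≈⟨ R.+-congˡ (R.*-congˡ (eval-extend (euler a) n (suc n) (ℕ.n≤1+n n))) ⟩
    eval b n + - 1ℝ * eval (euler a) n
      ≈⟨ R.+-congˡ (∑<-*ˡ (suc n) (- 1ℝ) λ k → euler a k * u^ k n) ⟩
    eval b n + ∑< (suc n) (λ k → - 1ℝ * (euler a k * u^ k n))
      ≈⟨ ∑<-+ (suc n) (λ k → b k * u^ k n) (λ k → - 1ℝ * (euler a k * u^ k n)) ⟨
    ∑< (suc n) (λ k → b k * u^ k n + - 1ℝ * (euler a k * u^ k n))
      ≈⟨ ∑<-cong (suc n) (λ k _ → solve 3 (λ b e x → b :* x :+ :- con 1ℚ :* (e :* x) := (b :- e) :* x)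
           R.refl (b k) (euler a k) (u^ k n)) ⟩
    eval (Δ a) n ∎
    where
    b : ℕ → ℝ
    b = ∂ a

  -- One step of Horner's scheme: a factor `u` is pulled out of all positive powers, and the two
  -- finite sums are exchanged.
  eval-unfold : ∀ a → eval a ≋ a 0 ∙ 1ₛ +ₛ u *ₛ eval (tail a)
  eval-unfold a = mk≋ λ n → R.trans (R.sym (eval-extend a n (suc n) (ℕ.n≤1+n n))) (R.+-congˡ (begin
    ∑< (suc n) (λ k → a (suc k) * u^ (suc k) n)
      ≈⟨ ∑<-cong (suc n) (λ k _ → ∑<-*ˡ (suc n) (a (suc k)) λ i → u i * u^ k (n ∸ i)) ⟩
    ∑< (suc n) (λ k → ∑< (suc n) (λ i → a (suc k) * (u i * u^ k (n ∸ i))))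
      ≈⟨ ∑<-cong (suc n) (λ k _ → ∑<-cong (suc n) λ i _ →
           solve 3 (λ x a y → a :* (x :* y) := x :* (a :* y)) R.refl (u i) (a (suc k)) (u^ k (n ∸ i))) ⟩
    ∑< (suc n) (λ k → ∑< (suc n) (λ i → u i * (a (suc k) * u^ k (n ∸ i))))
      ≈⟨ ∑-comm {suc n} {suc n} (λ k i → u (toℕ i) * (a (suc (toℕ k)) * u^ (toℕ k) (n ∸ toℕ i))) ⟩
    ∑< (suc n) (λ i → ∑< (suc n) (λ k → u i * (a (suc k) * u^ k (n ∸ i))))
      ≈⟨ ∑<-cong (suc n) (λ i _ → ∑<-*ˡ (suc n) (u i) λ k → a (suc k) * u^ k (n ∸ i)) ⟨
    ∑< (suc n) (λ i → u i * ∑< (suc n) (λ k → a (suc k) * u^ k (n ∸ i)))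
      -- The inner sum runs to `n`, while `eval` in degree `n ∸ i` stops earlier.
      ≈⟨ ∑<-cong (suc n) (λ i _ → R.*-congˡ {u i} (eval-extend (tail a) (n ∸ i) n (ℕ.m∸n≤m n i))) ⟩
    (u *ₛ eval (tail a)) n ∎))

  -- (1 - u)^x = e_μ^{-x}(t): both sides are eigenvectors of θ.
  eval-signedBinomial : ∀ x → eval (signedBinomial x) ≋ degExp μ (- x)
  eval-signedBinomial x = eigenvector-unique {(- x)}
    (solve 0 (con 1ℚ :* con 1ℚ :* con 1ℚ :* con 1ℚ :+ con 0ℚ := con 1ℚ :* con 1ℚ) R.refl)
    (S.trans (θ-eval w) (S.trans (eval-cong Δw) (eval-∙ (- x) w)))
    (θ-degExp (- x))
    where
    w = signedBinomial x
    Δw : ∀ k → Δ w k ≈ - x * w k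
    Δw k = R.trans (R.+-congʳ (signedBinomial-suc x k))
      (solve 3 (λ x m w → :- (x :- m) :* w :- m :* w := :- x :* w) R.refl x (fromNat k) (w k))

  degExp-neg-self-suc : ∀ n → degExp μ (- μ) (suc n) ≈ - μ * degExp μ (- μ) n
  degExp-neg-self-suc n = begin
    a′                                          ≈⟨ solve 3 (λ a′ a μ → a′ := con 1ℚ :* con 1ℚ :* a′ :+ μ :* a :+ :- μ :* a) R.refl a′ a μ ⟩
    1ℝ * 1ℝ * a′ + μ * a + - μ * a              ≈⟨ R.+-congʳ (R.+-congˡ (R.*-congˡ (*ₛ-identityˡ A n))) ⟨
    1ℝ * 1ℝ * a′ + μ * (1ₛ *ₛ A) n + - μ * a    ≈⟨ R.+-congʳ (R.+-congˡ (∙-*ₛ μ 1ₛ A n)) ⟨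
    1ℝ * 1ℝ * a′ + ((μ ∙ 1ₛ) *ₛ A) n + - μ * a  ≈⟨ R.+-congʳ (R.+-congˡ (*ₛ-cong {g = A} tail-degExp-self (λ _ → R.refl) n)) ⟨
    (degExp μ μ *ₛ A) (suc n) + - μ * a         ≈⟨ R.+-congʳ (at (degExp-inverse (R.-‿inverseʳ μ)) (suc n)) ⟩
    0ℝ + - μ * a                                ≈⟨ R.+-identityˡ _ ⟩
    - μ * a                                     ∎
    where
    A  = degExp μ (- μ)
    a  = A n
    a′ = A (suc n)

  -- Division by e_μ(t) - 1.

  degExp-1≋t*tail : degExp μ 1ℝ +ₛ -ₛ 1ₛ ≋ t *ₛ tail (degExp μ 1ℝ)
  degExp-1≋t*tail = mk≋ λ where
    zero    → solve 1 (λ e → con 1ℚ :* con 1ℚ :- con 1ℚ := con 0ℚ :* e :+ con 0ℚ) R.refl (degExp μ 1ℝ 1)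
    (suc n) → R.trans (R.trans (R.+-congˡ -0#≈0#) (R.+-identityʳ _)) (R.sym (t*ₛ-suc (tail (degExp μ 1ℝ)) n))

  -- With e_μ(t) - 1 = t Q, comparing coefficients one degree higher cancels t, and then Q is
  -- inverted by its reciprocal.
  t/⟨degExp-1⟩-unique : ∀ {f g} → (degExp μ 1ℝ +ₛ -ₛ 1ₛ) *ₛ f ≋ t *ₛ g → t/⟨degExp-1⟩ μ *ₛ g ≋ f
  t/⟨degExp-1⟩-unique {f} {g} p = SR.begin
    q *ₛ g          SR.≈⟨ S.*-congˡ {q} Q*f≋g ⟨
    q *ₛ (Q *ₛ f)   SR.≈⟨ S.*-assoc q Q f ⟨
    (q *ₛ Q) *ₛ f   SR.≈⟨ S.*-congʳ {f} (S.*-comm q Q) ⟩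
    (Q *ₛ q) *ₛ f   SR.≈⟨ S.*-congʳ {f} (mk≋ (reciprocal-inverseʳ Q Q0≈1)) ⟩
    1ₛ *ₛ f         SR.≈⟨ S.*-identityˡ f ⟩
    f               SR.∎
    where
    Q q : Series
    Q = tail (degExp μ 1ℝ)
    q = t/⟨degExp-1⟩ μ
    Q0≈1 : Q 0 ≈ 1ℝ
    Q0≈1 = solve 1 (λ μ → con 1ℚ :* (con 1ℚ :- con 0ℚ :* μ) :* con 1ℚ := con 1ℚ) R.refl μ
    Q*f≋g : Q *ₛ f ≋ g
    Q*f≋g = mk≋ λ n → begin
      (Q *ₛ f) n                                  ≈⟨ t*ₛ-suc (Q *ₛ f) n ⟨
      (t *ₛ (Q *ₛ f)) (suc n)                     ≈⟨ *ₛ-assoc t Q f (suc n) ⟨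
      ((t *ₛ Q) *ₛ f) (suc n)                     ≈⟨ *ₛ-cong {g = f} (at degExp-1≋t*tail) (λ _ → R.refl) (suc n) ⟨
      ((degExp μ 1ℝ +ₛ -ₛ 1ₛ) *ₛ f) (suc n)       ≈⟨ at p (suc n) ⟩
      (t *ₛ g) (suc n)                            ≈⟨ t*ₛ-suc g n ⟩
      g n                                         ∎

  -- Degenerate harmonic numbers and the series ∑ (H_k/k) u^k.

  module _ (μ#0 : μ # 0ℝ) where

    private
      μ⁻¹ : ℝ
      μ⁻¹ = μ ⁻¹⟨ μ#0 ⟩

    μ-cancel : ∀ {x y} → μ * x ≈ μ * y → x ≈ y
    μ-cancel {x} {y} p = begin
      x               ≈⟨ unscale x ⟩
      μ⁻¹ * (μ * x)   ≈⟨ R.*-congˡ p ⟩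
      μ⁻¹ * (μ * y)   ≈⟨ unscale y ⟨
      y               ∎
      where
      unscale : ∀ x → x ≈ μ⁻¹ * (μ * x)
      unscale x = begin
        x                ≈⟨ R.*-identityˡ x ⟨
        1ℝ * x           ≈⟨ R.*-congʳ (⁻¹-inverseʳ μ μ#0) ⟨
        μ * μ⁻¹ * x      ≈⟨ solve 3 (λ m i x → m :* i :* x := i :* (m :* x)) R.refl μ μ⁻¹ x ⟩
        μ⁻¹ * (μ * x)    ∎

    H : ℕ → ℝ
    H k = degHarmonic k μ μ#0

    -- The increment H_{k+1} - H_k, written so that `H k` is `∑< k ΔH` by computation.
    ΔH : ℕ → ℝ
    ΔH k = μ⁻¹ * binomial μ (suc k) * (- 1ℝ) ^ k

    -- H_k/k with 1/k written as (k-1)!/k!: the numerator becomes the factorial of the theorem, the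
    -- denominator goes into the Stirling number.
    H/ : ℕ → ℝ
    H/ zero    = 0ℝ
    H/ (suc k) = H (suc k) * (fromNat (k !) * 1/ suc k !)

    euler-H/ : ∀ k → euler H/ k ≈ H k
    euler-H/ zero    = R.zeroˡ 0ℝ
    euler-H/ (suc k) = begin
      s * (h * (k! * i))  ≈⟨ solve 4 (λ s h k! i → s :* (h :* (k! :* i)) := h :* (k! :* (s :* i))) R.refl s h k! i ⟩
      h * (k! * (s * i))  ≈⟨ R.*-congˡ (R.*-congˡ (suc*1/! k)) ⟩
      h * (k! * 1/ k !)   ≈⟨ R.*-congˡ (!*1/! k) ⟩
      h * 1ℝ              ≈⟨ R.*-identityʳ h ⟩
      h                   ∎
      where
      s  = fromNat (suc k)
      h  = H (suc k)
      k! = fromNat (k !)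
      i  = 1/ suc k !

    θ-eval-H/ : θ (eval H/) ≋ eval ΔH
    θ-eval-H/ = S.trans (θ-eval H/) (eval-cong λ k → begin
      euler H/ (suc k) - euler H/ k  ≈⟨ R.+-cong (euler-H/ (suc k)) (R.-‿cong (euler-H/ k)) ⟩
      H (suc k) - H k                ≈⟨ R.+-congʳ (∑<-last k ΔH) ⟩
      (H k + ΔH k) - H k             ≈⟨ solve 2 (λ x y → (x :+ y) :- x := y) R.refl (H k) (ΔH k) ⟩
      ΔH k                           ∎)

    -- u ∑ ΔH_k u^k = (1 - (1 - u)^μ)/μ, where (1 - u)^μ = e_μ^{-μ}(t) = 1/(1 + μt).
    u*eval-ΔH : u *ₛ eval ΔH ≋ t *ₛ degExp μ (- μ)
    u*eval-ΔH = mk≋ go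
      where
      w : ℕ → ℝ
      w = signedBinomial μ
      eval-tail-w : eval (tail w) ≋ - μ ∙ eval ΔH
      eval-tail-w = S.trans (eval-cong λ k → begin
        binomial μ (suc k) * (- 1ℝ * (- 1ℝ) ^ k)
          ≈⟨ R.*-identityˡ _ ⟨
        1ℝ * (binomial μ (suc k) * (- 1ℝ * (- 1ℝ) ^ k))
          ≈⟨ R.*-congʳ (⁻¹-inverseʳ μ μ#0) ⟨
        μ * μ⁻¹ * (binomial μ (suc k) * (- 1ℝ * (- 1ℝ) ^ k))
          ≈⟨ solve 4 (λ m i b p → m :* i :* (b :* (:- con 1ℚ :* p)) := :- m :* (i :* b :* p))
               R.refl μ μ⁻¹ (binomial μ (suc k)) ((- 1ℝ) ^ k) ⟩
        - μ * ΔH k ∎) (eval-∙ (- μ) ΔH)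

      go : u *ₛ eval ΔH ≈ₛ t *ₛ degExp μ (- μ)
      go zero    = R.+-congʳ (R.trans (R.*-congʳ u0≈0) (R.trans (R.zeroˡ _) (R.sym (R.zeroˡ _))))
      go (suc n) = R.trans (μ-cancel (begin
        μ * (u *ₛ eval ΔH) (suc n)
          -- The constant `w 0` contributes 0 in positive degree; adding it completes the expansion
          -- of (1 - u)^μ.
          ≈⟨ solve 3 (λ m x a → m :* x := :- (a :* con 0ℚ :+ :- m :* x)) R.refl μ _ (w 0) ⟩
        - (w 0 * 1ₛ (suc n) + - μ * (u *ₛ eval ΔH) (suc n))
          ≈⟨ R.-‿cong (R.+-congˡ (at (*ₛ-∙ (- μ) u (eval ΔH)) (suc n))) ⟨
        - (w 0 * 1ₛ (suc n) + (u *ₛ (- μ ∙ eval ΔH)) (suc n))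
          ≈⟨ R.-‿cong (R.+-congˡ (at (S.*-congˡ {u} eval-tail-w) (suc n))) ⟨
        - (w 0 * 1ₛ (suc n) + (u *ₛ eval (tail w)) (suc n))
          ≈⟨ R.-‿cong (at (eval-unfold w) (suc n)) ⟨
        - eval w (suc n)
          ≈⟨ R.-‿cong (R.trans (at (eval-signedBinomial μ) (suc n)) (degExp-neg-self-suc n)) ⟩
        - (- μ * degExp μ (- μ) n)
          ≈⟨ solve 2 (λ m a → :- (:- m :* a) := m :* a) R.refl μ (degExp μ (- μ) n) ⟩
        μ * degExp μ (- μ) n ∎)) (R.sym (t*ₛ-suc (degExp μ (- μ)) n))

    bernoulli-series : t/⟨degExp-1⟩ μ *ₛ degExp μ (1ℝ + (- μ + - μ)) ≋ ∂ (eval H/)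
    bernoulli-series = t/⟨degExp-1⟩-unique (SR.begin
      (E +ₛ -ₛ 1ₛ) *ₛ G              SR.≈⟨ S.*-congʳ {G} degExp*u ⟨
      (E *ₛ u) *ₛ G                  SR.≈⟨ S.*-congˡ {E *ₛ u} (S.*-identityˡ G) ⟨
      (E *ₛ u) *ₛ (1ₛ *ₛ G)          SR.≈⟨ S.*-congˡ {E *ₛ u} (S.*-congʳ {G} (degExp-inverse (R.-‿inverseˡ μ))) ⟨
      (E *ₛ u) *ₛ ((A *ₛ B) *ₛ G)
        SR.≈⟨ M.solve 5 (λ e u a b g → (e M.⊕ u) M.⊕ ((a M.⊕ b) M.⊕ g) M.⊜ (e M.⊕ a) M.⊕ (u M.⊕ (b M.⊕ g)))
                S.refl E u A B G ⟩
      (E *ₛ A) *ₛ (u *ₛ (B *ₛ G))    SR.≈⟨ S.*-congˡ {E *ₛ A} (S.*-congˡ {u} (S.trans (S.sym (θ≋degExp*∂ (eval H/))) θ-eval-H/)) ⟩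
      (E *ₛ A) *ₛ (u *ₛ eval ΔH)     SR.≈⟨ S.*-congˡ {E *ₛ A} u*eval-ΔH ⟩
      (E *ₛ A) *ₛ (t *ₛ A)           SR.≈⟨ M.solve 3 (λ e a t → (e M.⊕ a) M.⊕ (t M.⊕ a) M.⊜ t M.⊕ (e M.⊕ (a M.⊕ a))) S.refl E A t ⟩
      t *ₛ (E *ₛ (A *ₛ A))           SR.≈⟨ S.*-congˡ {t} (S.trans (S.*-congˡ {E} (degExp-+ (- μ) (- μ))) (degExp-+ 1ℝ (- μ + - μ))) ⟩
      t *ₛ degExp μ (1ℝ + (- μ + - μ)) SR.∎)
      where
      module M = MonoidSolver S.*-commutativeMonoid
      E A B G : Series
      E = degExp μ 1ℝ
      A = degExp μ (- μ)
      B = degExp μ μ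
      G = ∂ (eval H/)

-- Degenerate Stirling numbers as coefficients of powers of u

falling-zero-suc : ∀ k → falling 0ℝ (suc k) ≈ 0ℝ
falling-zero-suc zero    = solve 0 (con 1ℚ :* (con 0ℚ :- con 0ℚ) := con 0ℚ) R.refl
falling-zero-suc (suc k) = R.trans (R.*-congʳ (falling-zero-suc k)) (R.zeroˡ _)

-- Here the first factor is split off, whereas the definition splits off the last.
falling-suc-suc : ∀ m k → falling (fromNat (suc m)) (suc k) ≈ fromNat (suc m) * falling (fromNat m) k
falling-suc-suc m zero    = solve 1 (λ s → con 1ℚ :* (s :- con 0ℚ) := s :* con 1ℚ) R.refl (fromNat (suc m))
falling-suc-suc m (suc k) = begin
  falling s (suc k) * (s - fromNat (suc k))
    ≈⟨ R.*-cong (falling-suc-suc m k) (R.+-cong (fromNat-suc m) (R.-‿cong (fromNat-suc k))) ⟩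
  s * F * ((1ℝ + fromNat m) - (1ℝ + fromNat k))
    ≈⟨ solve 4 (λ s F m k → s :* F :* ((con 1ℚ :+ m) :- (con 1ℚ :+ k)) := s :* (F :* (m :- k)))
         R.refl s F (fromNat m) (fromNat k) ⟩
  s * (F * (fromNat m - fromNat k)) ∎
  where
  s = fromNat (suc m)
  F = falling (fromNat m) k

-- Evaluation at 0 isolates the constant coefficient. At `m + 1`, removing it and cancelling `m + 1`
-- leaves the same hypothesis at `m` for the tails.
falling-coefficients-unique : ∀ n {c d : ℕ → ℝ} →
  (∀ m → ∑< n (λ k → c k * falling (fromNat m) k) ≈ ∑< n (λ k → d k * falling (fromNat m) k)) →
  ∀ k → k < n → c k ≈ d k
falling-coefficients-unique (suc n) {c} {d} eq = λ where
    zero    _         → c0≈d0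
    (suc k) (s≤s k<n) → falling-coefficients-unique n {tail c} {tail d} tail-eq k k<n
  where
  at-zero : ∀ c → ∑< (suc n) (λ k → c k * falling (fromNat 0) k) ≈ c 0
  at-zero c = R.trans (R.+-cong (R.*-identityʳ (c 0))
    (∑<-zero n λ k _ → R.trans (R.*-congˡ {c (suc k)} (falling-zero-suc k)) (R.zeroʳ (c (suc k))))) (R.+-identityʳ (c 0))

  c0≈d0 : c 0 ≈ d 0
  c0≈d0 = R.trans (R.sym (at-zero c)) (R.trans (eq 0) (at-zero d))

  at-suc : ∀ c m → ∑< (suc n) (λ k → c k * falling (fromNat (suc m)) k)
         ≈ c 0 * 1ℝ + fromNat (suc m) * ∑< n (λ k → c (suc k) * falling (fromNat m) k)
  at-suc c m = R.+-congˡ (R.trans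
    (∑<-cong n λ k _ → R.trans (R.*-congˡ {c (suc k)} (falling-suc-suc m k))
      (solve 3 (λ c s F → c :* (s :* F) := s :* (c :* F)) R.refl (c (suc k)) (fromNat (suc m)) (falling (fromNat m) k)))
    (R.sym (∑<-*ˡ n (fromNat (suc m)) λ k → c (suc k) * falling (fromNat m) k)))

  tail-eq : ∀ m → ∑< n (λ k → c (suc k) * falling (fromNat m) k) ≈ ∑< n (λ k → d (suc k) * falling (fromNat m) k)
  tail-eq m = suc-cancel m (+-cancelˡ (c 0 * 1ℝ) _ _ (R.trans (R.sym (at-suc c m))
    (R.trans (eq (suc m)) (R.trans (at-suc d m) (R.+-congʳ (R.*-congʳ (R.sym c0≈d0)))))))

-1^n*-1^n≈1 : ∀ n → (- 1ℝ) ^ n * (- 1ℝ) ^ n ≈ 1ℝ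
-1^n*-1^n≈1 zero    = R.*-identityˡ 1ℝ
-1^n*-1^n≈1 (suc n) = R.trans
  (solve 1 (λ p → (:- con 1ℚ :* p) :* (:- con 1ℚ :* p) := p :* p) R.refl ((- 1ℝ) ^ n)) (-1^n*-1^n≈1 n)

-1^[n∸k]*-1^k : ∀ {k n} → k ≤ n → (- 1ℝ) ^ (n ∸ k) * (- 1ℝ) ^ k ≈ (- 1ℝ) ^ n
-1^[n∸k]*-1^k {k} {n} k≤n = R.trans (R.sym (^-homo-* (- 1ℝ) (n ∸ k) k)) (^-congʳ (- 1ℝ) (ℕ.m∸n+n≡m k≤n))

-- Each of the n factors changes sign; this links the parameter λ of the Stirling numbers with μ =
-- -λ.
degFalling-neg : ∀ μ x n → degFalling (- μ) (- x) n ≈ (- 1ℝ) ^ n * degFalling μ x n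
degFalling-neg μ x zero    = R.sym (R.*-identityˡ 1ℝ)
degFalling-neg μ x (suc n) = R.trans (R.*-congʳ (degFalling-neg μ x n))
  (solve 5 (λ p d x k μ → p :* d :* (:- x :- k :* :- μ) := :- con 1ℚ :* p :* (d :* (x :- k :* μ)))
    R.refl ((- 1ℝ) ^ n) (degFalling μ x n) x (fromNat n) μ)

module _ (lam : ℝ) where

  -- The sign is kept as two powers because (-1)^n comes from `degFalling-neg` and (-1)^k from
  -- `signedBinomial`.
  u^-coefficient : ℕ → ℕ → ℝ
  u^-coefficient n k = (- 1ℝ) ^ n * (- 1ℝ) ^ k * fromNat (n !) * 1/ k ! * u^ (- lam) k n

  u^-coefficient-isDegStirling₂ : IsDegStirling₂ lam u^-coefficient
  u^-coefficient-isDegStirling₂ n x = begin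
    d
      ≈⟨ R.trans (R.*-identityˡ _) (R.*-identityˡ d) ⟨
    1ℝ * (1ℝ * d)
      ≈⟨ R.*-cong (-1^n*-1^n≈1 n) (R.*-congʳ (!*1/! n)) ⟨
    p * p * (n! * i * d)
      ≈⟨ solve 4 (λ p n! i d → p :* p :* (n! :* i :* d) := p :* n! :* (p :* d :* i)) R.refl p n! i d ⟩
    p * n! * (p * d * i)
      ≈⟨ R.*-congˡ (R.*-congʳ (degFalling-neg lam x n)) ⟨
    p * n! * degExp (- lam) (- x) n
      ≈⟨ R.*-congˡ (at (eval-signedBinomial (- lam) x) n) ⟨
    p * n! * eval (- lam) (signedBinomial x) n
      ≈⟨ ∑<-*ˡ (suc n) (p * n!) (λ k → signedBinomial x k * u^ (- lam) k n) ⟩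
    ∑< (suc n) (λ k → p * n! * (signedBinomial x k * u^ (- lam) k n))
      ≈⟨ ∑<-cong (suc n) (λ k _ →
           solve 6 (λ p n! F i q v → p :* n! :* (F :* i :* q :* v) := p :* q :* n! :* i :* v :* F)
             R.refl p n! (falling x k) (1/ k !) ((- 1ℝ) ^ k) (u^ (- lam) k n)) ⟩
    ∑₀ n (λ k → u^-coefficient n k * falling x k) ∎
    where
    d  = degFalling lam x n
    p  = (- 1ℝ) ^ n
    n! = fromNat (n !)
    i  = 1/ n !

-- Comparison of coefficients of t^(n-1).

theorem9 : (lam : ℝ) (lam#0 : lam # 0ℝ) (S₂ : ℕ → ℕ → ℝ) → IsDegStirling₂ lam S₂ →
    (n : ℕ) → 1 ≤ n →
    degBernoulli (n ∸ 1) (- lam) (fromNat 2 * lam + 1ℝ)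
    ≈ ∑₁ n (λ k → fromNat ((k ∸ 1) !) * (- 1ℝ) ^ (n ∸ k) * degHarmonic k (- lam) (-‿#0 lam#0) * S₂ n k)
theorem9 lam lam#0 S₂ isS₂ (suc m) _ = begin
  fromNat (m !) * (t/⟨degExp-1⟩ μ *ₛ degExp μ (fromNat 2 * lam + 1ℝ)) m
    -- With μ = -λ the argument 2λ + 1 is 1 - 2μ.
    ≈⟨ R.*-congˡ (at (S.*-congˡ {t/⟨degExp-1⟩ μ} (degExp-cong μ
         (solve 1 (λ l → con (+ 2 ℚ./ 1) :* l :+ con 1ℚ := con 1ℚ :+ (:- :- l :+ :- :- l)) R.refl lam))) m) ⟩
  fromNat (m !) * (t/⟨degExp-1⟩ μ *ₛ degExp μ (1ℝ + (- μ + - μ))) m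
    ≈⟨ R.*-congˡ (at (bernoulli-series μ (-‿#0 lam#0)) m) ⟩
  fromNat (m !) * (fromNat n * eval μ h n)
    -- The factor `n` produced by the derivative completes (n-1)! to n!.
    ≈⟨ R.trans (solve 3 (λ a b c → a :* (b :* c) := b :* a :* c) R.refl (fromNat (m !)) (fromNat n) (eval μ h n))
         (R.*-congʳ (R.sym (fromNat-* n (m !)))) ⟩
  n! * (0ℝ * 1ₛ n + ∑< n (λ k → h (suc k) * u^ μ (suc k) n))
    ≈⟨ R.*-congˡ (R.trans (R.+-congʳ (R.zeroˡ _)) (R.+-identityˡ _)) ⟩
  n! * ∑< n (λ k → h (suc k) * u^ μ (suc k) n)
    ≈⟨ ∑<-*ˡ n n! (λ k → h (suc k) * u^ μ (suc k) n) ⟩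
  ∑< n (λ k → n! * (h (suc k) * u^ μ (suc k) n))
    ≈⟨ ∑<-cong n term ⟩
  ∑₁ n (λ k → fromNat ((k ∸ 1) !) * (- 1ℝ) ^ (n ∸ k) * degHarmonic k μ (-‿#0 lam#0) * S₂ n k) ∎
  where
  n  = suc m
  μ  = - lam
  n! = fromNat (n !)
  h : ℕ → ℝ
  h = H/ μ (-‿#0 lam#0)

  -- The expansion pins down `S₂ n k` only for `k ≤ n`, which covers every term of the sum.
  S₂≈ : ∀ k → k < suc n → u^-coefficient lam n k ≈ S₂ n k
  S₂≈ = falling-coefficients-unique (suc n) λ j →
    R.trans (R.sym (u^-coefficient-isDegStirling₂ lam n (fromNat j))) (isS₂ n (fromNat j))

  term : ∀ k → k < n → n! * (h (suc k) * u^ μ (suc k) n)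
       ≈ fromNat (k !) * (- 1ℝ) ^ (m ∸ k) * degHarmonic (suc k) μ (-‿#0 lam#0) * S₂ n (suc k)
  term k k<n = begin
    n! * (Hk * (k! * i) * v)
      ≈⟨ R.*-identityˡ _ ⟨
    1ℝ * (n! * (Hk * (k! * i) * v))
      -- Of the two copies of (-1)^n, one splits into the sign (-1)^(n-(k+1)) of the theorem and
      -- (-1)^(k+1); the latter joins the other copy in `u^-coefficient`.
      ≈⟨ R.*-congʳ (-1^n*-1^n≈1 n) ⟨
    q * q * (n! * (Hk * (k! * i) * v))
      ≈⟨ R.*-congʳ (R.*-congʳ (-1^[n∸k]*-1^k k<n)) ⟨
    r * p * q * (n! * (Hk * (k! * i) * v))
      ≈⟨ solve 8 (λ r p q n! H k! i v → r :* p :* q :* (n! :* (H :* (k! :* i) :* v))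
                                      := k! :* r :* H :* (q :* p :* n! :* i :* v))
           R.refl r p q n! Hk k! i v ⟩
    k! * r * Hk * u^-coefficient lam n (suc k)
      ≈⟨ R.*-congˡ (S₂≈ (suc k) (s≤s k<n)) ⟩
    k! * r * Hk * S₂ n (suc k) ∎
    where
    Hk = degHarmonic (suc k) μ (-‿#0 lam#0)
    k! = fromNat (k !)
    i  = 1/ suc k !
    v  = u^ μ (suc k) n
    q  = (- 1ℝ) ^ n
    p  = (- 1ℝ) ^ suc k
    r  = (- 1ℝ) ^ (m ∸ k)
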